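{- Let $\mathbf{V}=(V_n)_{n\in\mathbb{N}}$ be a good ssee and let $k,N\in\mathbb{N}$. Let $\mathcal{F}$ be a nonempty collection of $k$-colourings of $V_N$ and let $\mathcal{P}=\mathrm{Forb}_{\mathbf{V}}(\mathcal{F})$. For any $\varepsilon>0$ there exists $n_0>0$ such that for any $n\ge n_0$ there is a collection $\mathcal{T}_n$ of $k$-colouring templates for $V_n$ satisfying: (i) for every $c\in\mathcal{P}_n$ there is $t\in\mathcal{T}_n$ with $c\in\langle t\rangle$; (ii) for each $t\in\mathcal{T}_n$ there are at most $\varepsilon\bigl|\binom{V_n}{V_N}\bigr|$ pairs $(\phi,c)$ with $\phi\in\binom{V_n}{V_N}$, $c\in\mathcal{F}$ and $c\in\langle t_{|\phi}\rangle$; (iii) $|\mathcal{T}_n|\le k^{\varepsilon|V_n|}$.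
   Context: A set-sequence equipped with embeddings (ssee) is a sequence $\mathbf{V}=(V_n)_{n\in\mathbb{N}}$ of (finite) sets together with, for every $N\le n$, a collection $\binom{V_n}{V_N}$ of injections $\phi:V_N\to V_n$ (called embeddings). For a set $V$, a $k$-colouring of $V$ is a map $c:V\to[k]$ and a $k$-colouring template of $V$ is a map $t:V\to2^{[k]}\setminus\{\emptyset\}$; $\langle t\rangle$ is the set of $k$-colourings $c$ of $V$ with $c(x)\in t(x)$ for all $x$. For $\phi\in\binom{V_n}{V_N}$, $t_{|\phi}(x)=t(\phi(x))$ and $c_{|\phi}(x)=c(\phi(x))$ for $x\in V_N$. $\mathrm{Forb}_{\mathbf{V}}(\mathcal{F})_n$ is the set of $k$-colourings $c$ of $V_n$ with $c_{|\phi}\notin\mathcal{F}$ for all $\phi\in\binom{V_n}{V_N}$. For $N\le n$ and $i$, let $I_i$ be the number of maps $\phi$ from the disjoint union of two copies of $V_N$ to $V_n$ whose restriction to each copy lies in $\binom{V_n}{V_N}$ and such that the images of the two copies meet in exactly $i$ elements; set $I(N,n)=\sum_{1<i<|V_N|}I_i$. The ssee $\mathbf{V}$ is good if (i) $|V_n|\to\infty$; (ii) for all $N$ with $|V_N|>1$, $\bigl|\binom{V_n}{V_N}\bigr|/|V_n|\to\infty$ as $n\to\infty$; (iii) for all $N$ with $|V_N|>1$, $|V_n|\,I(N,n)/\bigl|\binom{V_n}{V_N}\bigr|^2\to0$ as $n\to\infty$. -}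

module Defs where

open import Data.Nat using (ℕ; zero; suc; _+_; _*_; _^_; _≤_; _<_; _<?_)
open import Data.Fin using (Fin)
import Data.Fin as F
open import Data.Fin.Properties using (all?)
open import Data.Fin.Subset as S using (Subset; Nonempty)
open import Data.Fin.Subset.Properties as SP using ()
open import Data.Vec using (Vec; lookup; map)
import Data.Vec.Membership.Propositional as VM
import Data.Vec.Membership.DecPropositional as VMD
open import Data.List using (List; length; filter; cartesianProduct; allFin; sum)
import Data.List as L
open import Data.List.Membership.Propositional as LM using ()
open import Data.List.Relation.Unary.Unique.Propositional using (Unique)
open import Data.Product using (_×_; _,_; Σ; ∃)
open import Relation.Nullary using (¬_; Dec)
open import Relation.Nullary.Decidable using (_×-dec_)
open import Relation.Binary.PropositionalEquality using (_≡_)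
open import Function.Definitions using (Injective)

-- Set-sequences equipped with embeddings.
-- V_n is modelled as Fin (size n); an embedding φ : V_N → V_n is stored
-- as its table of values, a Vec (Fin (size n)) (size N).
-- The collection binom(V_n, V_N) is a duplicate-free list of injections.
-- It is only meaningful for N ≤ n; for n < N we require it to be empty.

Emb : ℕ → ℕ → Set
Emb a b = Vec (Fin b) a

record SSEE : Set where
  field
    size      : ℕ → ℕ
    emb       : (N n : ℕ) → List (Emb (size N) (size n))
    emb-inj   : ∀ N n φ → φ LM.∈ emb N n → Injective _≡_ _≡_ (lookup φ)
    emb-uniq  : ∀ N n → Unique (emb N n)
    emb-undef : ∀ N n → n < N → emb N n ≡ L.[]

open SSEE public

Colouring : ℕ → ℕ → Set
Colouring k s = Vec (Fin k) s

record Template (k s : ℕ) : Set where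
  constructor template
  field
    tmpl     : Vec (Subset k) s
    nonempty : ∀ x → Nonempty (lookup tmpl x)

open Template public

_∈⟨_⟩ : ∀ {k s} → Colouring k s → Vec (Subset k) s → Set
c ∈⟨ t ⟩ = ∀ x → lookup c x S.∈ lookup t x

_∈⟨_⟩? : ∀ {k s} (c : Colouring k s) (t : Vec (Subset k) s) → Dec (c ∈⟨ t ⟩)
c ∈⟨ t ⟩? = all? (λ x → lookup c x SP.∈? lookup t x)

restrict : ∀ {A : Set} {a b} → Vec A b → Emb a b → Vec A a
restrict f φ = map (lookup f) φ

InForb : (V : SSEE) (k N : ℕ) (𝓕 : List (Colouring k (size V N))) (n : ℕ) →
         Colouring k (size V n) → Set
InForb V k N 𝓕 n c = ∀ φ → φ LM.∈ emb V N n → ¬ (restrict c φ LM.∈ 𝓕)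

badPairs : (V : SSEE) (k N : ℕ) (𝓕 : List (Colouring k (size V N))) (n : ℕ) →
           Template k (size V n) → ℕ
badPairs V k N 𝓕 n t =
  length (filter (λ p → Data.Product.proj₂ p ∈⟨ restrict (tmpl t) (Data.Product.proj₁ p) ⟩?)
                 (cartesianProduct (emb V N n) 𝓕))

imgOverlap : ∀ {a b} → Emb a b → Emb a b → ℕ
imgOverlap {b = b} φ ψ =
  length (filter (λ y → VMD._∈?_ F._≟_ y φ ×-dec VMD._∈?_ F._≟_ y ψ) (allFin b))

Icount : (V : SSEE) (N n : ℕ) → ℕ
Icount V N n =
  length (filter (λ p → (1 <? imgOverlap (Data.Product.proj₁ p) (Data.Product.proj₂ p))
                        ×-dec (imgOverlap (Data.Product.proj₁ p) (Data.Product.proj₂ p) <? size V N))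
                 (cartesianProduct (emb V N n) (emb V N n)))

-- Good ssee.  "x_n → ∞" : ∀ M, eventually M ≤ x_n.
-- "a_n / b_n → 0" (a_n, b_n ≥ 0): ∀ m, eventually (m+1)·a_n ≤ b_n.

Good : SSEE → Set
Good V =
    (∀ M → ∃ λ n₁ → ∀ n → n₁ ≤ n → M ≤ size V n)
  × (∀ N → 1 < size V N → ∀ M → ∃ λ n₁ → ∀ n → n₁ ≤ n →
        M * size V n ≤ length (emb V N n))
  × (∀ N → 1 < size V N → ∀ m → ∃ λ n₁ → ∀ n → n₁ ≤ n →
        suc m * (size V n * Icount V N n) ≤ length (emb V N n) ^ 2)

{-# OPTIONS --safe #-}

-- A pair (φ, f) with f forbidden is the tuple of vertices (φ x, f x) of V_n × [k]; a colouring in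
-- Forb is an independent set I of the hypergraph of these tuples.  Conditions (ii) and (iii) bound
-- the sum of the squared codegrees, so after discarding few φ all codegrees of pairs of vertices are
-- at most L with L |V_n| a tiny fraction of the number of edges; no bound on degrees is needed.
--
-- The coordinates of the edges are treated one by one.  Given edges K whose previous coordinates are
-- known to lie in I, scan all vertices y, collecting edges K′ ⊆ K whose current coordinate lies in I.
-- The question "y ∈ I?" is asked only if many uncollected edges of K have current coordinate y and no
-- later coordinate saturated (a vertex is saturated once its degree in K′ reaches 1/C of its original
-- degree).  A positive answer adds all these edges to K′; as saturation bounds |K′|, positive answers
-- are rare, hence few answer patterns occur.  If K′ ends up dense, go on with the next coordinate; at
-- the last one all vertices met by K′ lie outside I.  If K′ is sparse then few edges meet saturated
-- vertices, so most edges of K have their current coordinate among the vertices answered negatively.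
-- Either way a known set of vertices outside I meets a constant proportion of all edges.  Deleting it
-- and repeating boundedly often leaves at most ε |E| edges.
module Submission where

open import Defs
open import Data.Bool using (Bool; true; false; _∧_; _∨_; not)
open import Data.Bool.ListAction using (any)
open import Data.Empty using (⊥)
open import Data.Fin using (Fin; zero; suc; combine; remQuot)
import Data.Fin.Properties as Finₚ
open import Data.Fin.Subset as Subset using (Subset)
import Data.Fin.Subset.Properties as Subsetₚ
open import Data.List using (List; []; _∷_; _++_; length; map; filter; cartesianProduct; cartesianProductWith; allFin; tabulate)
open import Data.List.Membership.Propositional using (_∈_; find; lose)
open import Data.List.Membership.Propositional.Properties using (∈-++⁺ˡ; ∈-++⁺ʳ; ∈-++⁻; ∈-∃++; ∈-allFin; ∈-filter⁺; ∈-filter⁻; ∈-map⁺; ∈-map⁻; ∈-cartesianProduct⁻; ∈-cartesianProductWith⁺)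
open import Data.List.Properties using (length-++; length-map; length-tabulate)
open import Data.List.Relation.Unary.All as All using (All; []; _∷_)
open import Data.List.Relation.Unary.AllPairs as AllPairs using (AllPairs; []; _∷_)
import Data.List.Relation.Unary.AllPairs.Properties as AllPairsₚ
open import Data.List.Relation.Unary.Any as Any using (Any; here; there)
open import Data.List.Relation.Unary.Unique.Propositional using (Unique)
import Data.List.Relation.Unary.Unique.Propositional.Properties as Uniqueₚ
open import Data.Nat using (ℕ; zero; suc; _+_; _*_; _^_; _≤_; _<_; z≤n; s≤s; _≤?_; _<?_; NonZero; >-nonZero)
open import Data.Nat.DivMod using (_/_; _%_; m≡m%n+[m/n]*n; m%n<n; m/n*n≤m)
open import Data.Nat.Properties
open import Data.Nat.Tactic.RingSolver using (solve-∀)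
open import Data.Product using (_×_; _,_; ∃; Σ; proj₁; proj₂)
open import Data.Sum using (_⊎_; inj₁; inj₂; [_,_]′)
open import Data.Unit using (⊤; tt)
open import Data.Vec as Vec using (Vec; []; _∷_; lookup; toList)
import Data.Vec.Membership.DecPropositional as VecDec
import Data.Vec.Membership.Propositional as VecMem
open import Data.Vec.Membership.Propositional.Properties using (∈-lookup; ∈-toList⁺)
import Data.Vec.Properties as Vecₚ
open import Function using (_∘_; id)
open import Function.Definitions using (Injective)
open import Level using (0ℓ)
open import Relation.Binary.PropositionalEquality
open import Relation.Nullary using (Dec; does; yes; no; contradiction; ¬_)
open import Relation.Nullary.Decidable using (dec-true; dec-false; _×-dec_)
open import Relation.Unary using (Pred; Decidable)

private variable
  𝕏 𝕐 𝕐′ Ω : Set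

-- Finite sums and counting over lists.

∑ : List 𝕏 → (𝕏 → ℕ) → ℕ
∑ []       f = 0
∑ (x ∷ xs) f = f x + ∑ xs f

𝟙 : Bool → ℕ
𝟙 true  = 1
𝟙 false = 0

count : (𝕏 → Bool) → List 𝕏 → ℕ
count p xs = ∑ xs (𝟙 ∘ p)

∑-mono-∈ : ∀ (xs : List 𝕏) {f g : 𝕏 → ℕ} → (∀ x → x ∈ xs → f x ≤ g x) → ∑ xs f ≤ ∑ xs g
∑-mono-∈ []       f≤g = z≤n
∑-mono-∈ (x ∷ xs) f≤g = +-mono-≤ (f≤g x (here refl)) (∑-mono-∈ xs (λ y → f≤g y ∘ there))

∑-mono : ∀ (xs : List 𝕏) {f g : 𝕏 → ℕ} → (∀ x → f x ≤ g x) → ∑ xs f ≤ ∑ xs g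
∑-mono xs f≤g = ∑-mono-∈ xs (λ x _ → f≤g x)

∑-cong : ∀ (xs : List 𝕏) {f g : 𝕏 → ℕ} → (∀ x → f x ≡ g x) → ∑ xs f ≡ ∑ xs g
∑-cong []       f≡g = refl
∑-cong (x ∷ xs) f≡g = cong₂ _+_ (f≡g x) (∑-cong xs f≡g)

∑-+ : ∀ (xs : List 𝕏) (f g : 𝕏 → ℕ) → ∑ xs (λ x → f x + g x) ≡ ∑ xs f + ∑ xs g
∑-+ []       f g = refl
∑-+ (x ∷ xs) f g = trans (cong (f x + g x +_) (∑-+ xs f g)) (interchange (f x) (g x) _ _)
  where
  interchange : ∀ a b c d → a + b + (c + d) ≡ a + c + (b + d)
  interchange = solve-∀

∑-* : ∀ c (xs : List 𝕏) (f : 𝕏 → ℕ) → c * ∑ xs f ≡ ∑ xs (λ x → c * f x)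
∑-* c []       f = *-zeroʳ c
∑-* c (x ∷ xs) f = trans (*-distribˡ-+ c (f x) _) (cong (c * f x +_) (∑-* c xs f))

∑-const : ∀ (xs : List 𝕏) c → ∑ xs (λ _ → c) ≡ length xs * c
∑-const []       c = refl
∑-const (x ∷ xs) c = cong (c +_) (∑-const xs c)

∑-zero : ∀ (xs : List 𝕏) → ∑ xs (λ _ → 0) ≡ 0
∑-zero xs = trans (∑-const xs 0) (*-zeroʳ (length xs))

∑-swap : ∀ (xs : List 𝕏) (ys : List 𝕐) (f : 𝕏 → 𝕐 → ℕ) →
         ∑ xs (λ x → ∑ ys (f x)) ≡ ∑ ys (λ y → ∑ xs (λ x → f x y))
∑-swap []       ys f = sym (∑-zero ys)
∑-swap (x ∷ xs) ys f =
  trans (cong (∑ ys (f x) +_) (∑-swap xs ys f)) (sym (∑-+ ys (f x) _))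

∑-++ : ∀ (xs ys : List 𝕏) (f : 𝕏 → ℕ) → ∑ (xs ++ ys) f ≡ ∑ xs f + ∑ ys f
∑-++ []       ys f = refl
∑-++ (x ∷ xs) ys f = trans (cong (f x +_) (∑-++ xs ys f)) (sym (+-assoc (f x) _ _))

∑-map : ∀ (g : 𝕏 → 𝕐) (xs : List 𝕏) (f : 𝕐 → ℕ) → ∑ (map g xs) f ≡ ∑ xs (f ∘ g)
∑-map g []       f = refl
∑-map g (x ∷ xs) f = cong (f (g x) +_) (∑-map g xs f)

∑-cartesianProduct : ∀ (xs : List 𝕏) (ys : List 𝕐) (f : 𝕏 × 𝕐 → ℕ) →
                     ∑ (cartesianProduct xs ys) f ≡ ∑ xs (λ x → ∑ ys (λ y → f (x , y)))
∑-cartesianProduct []       ys f = refl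
∑-cartesianProduct (x ∷ xs) ys f =
  trans (∑-++ (map (x ,_) ys) _ f)
        (cong₂ _+_ (∑-map (x ,_) ys f) (∑-cartesianProduct xs ys f))

∑-tabulate : ∀ {n} (g : Fin n → 𝕏) (f : 𝕏 → ℕ) → ∑ (tabulate g) f ≡ ∑ (allFin n) (f ∘ g)
∑-tabulate {n = zero}  g f = refl
∑-tabulate {n = suc n} g f =
  cong (f (g zero) +_) (trans (∑-tabulate (g ∘ suc) f) (sym (∑-tabulate suc (f ∘ g))))

_≡ᵇ_ : ∀ {n} → Fin n → Fin n → Bool
x ≡ᵇ y = does (x Finₚ.≟ y)

≡ᵇ-sound : ∀ {n} (x y : Fin n) → (x ≡ᵇ y) ≡ true → x ≡ y
≡ᵇ-sound x y eq with x Finₚ.≟ y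
... | yes x≡y = x≡y

≡ᵇ-refl : ∀ {n} (x : Fin n) → (x ≡ᵇ x) ≡ true
≡ᵇ-refl x with x Finₚ.≟ x
... | yes _  = refl
... | no x≢x with () ← x≢x refl

∑-δ : ∀ {n} (x : Fin n) (h : Fin n → ℕ) → ∑ (allFin n) (λ u → 𝟙 (x ≡ᵇ u) * h u) ≡ h x
∑-δ {suc n} zero h =
  trans (cong₂ _+_ (+-identityʳ (h zero))
          (trans (∑-tabulate {n = n} suc (λ u → 𝟙 (zero ≡ᵇ u) * h u)) (∑-zero (allFin n))))
        (+-identityʳ (h zero))
∑-δ {suc n} (suc x) h =
  trans (∑-tabulate {n = n} suc (λ u → 𝟙 (suc x ≡ᵇ u) * h u)) (∑-δ x (h ∘ suc))

∑-allFin-const : ∀ n c → ∑ (allFin n) (λ _ → c) ≡ n * c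
∑-allFin-const n c = trans (∑-const (allFin n) c) (cong (_* c) (length-tabulate {n = n} id))

𝟙-mono : ∀ {a b} → (a ≡ true → b ≡ true) → 𝟙 a ≤ 𝟙 b
𝟙-mono {false}     a⇒b = z≤n
𝟙-mono {true}  {b} a⇒b rewrite a⇒b refl = ≤-refl

𝟙-* : ∀ b {x y} → (b ≡ true → x ≤ y) → 𝟙 b * x ≤ y
𝟙-* false         x≤y = z≤n
𝟙-* true  {x} {y} x≤y = ≤-trans (≤-reflexive (+-identityʳ x)) (x≤y refl)

count-mono : ∀ (xs : List 𝕏) {p q : 𝕏 → Bool} → (∀ x → p x ≡ true → q x ≡ true) →
             count p xs ≤ count q xs
count-mono xs p⇒q = ∑-mono xs (λ x → 𝟙-mono (p⇒q x))

count≤length : ∀ (p : 𝕏 → Bool) xs → count p xs ≤ length xs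
count≤length p []       = z≤n
count≤length p (x ∷ xs) with p x
... | true  = s≤s (count≤length p xs)
... | false = m≤n⇒m≤1+n (count≤length p xs)

count-false : ∀ (xs : List 𝕏) {p : 𝕏 → Bool} → (∀ x → p x ≡ true → false ≡ true) → count p xs ≡ 0
count-false xs p⇒⊥ = n≤0⇒n≡0 (≤-trans (count-mono xs {q = λ _ → false} p⇒⊥) (≤-reflexive (∑-zero xs)))

count-witness : ∀ (p : 𝕏 → Bool) xs → 1 ≤ count p xs → ∃ λ x → x ∈ xs × p x ≡ true
count-witness p (x ∷ xs) 1≤n with p x in eq
... | true  = x , here refl , eq
... | false with count-witness p xs 1≤n
...   | y , y∈xs , py = y , there y∈xs , py

length-filter-count : ∀ {P : Pred 𝕏 0ℓ} (P? : Decidable P) xs →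
                      length (filter P? xs) ≡ count (does ∘ P?) xs
length-filter-count P? []       = refl
length-filter-count P? (x ∷ xs) with does (P? x)
... | true  = cong suc (length-filter-count P? xs)
... | false = length-filter-count P? xs

any-true : ∀ (p : 𝕏 → Bool) {x} xs → x ∈ xs → p x ≡ true → any p xs ≡ true
any-true p (x ∷ xs) (here refl)  px rewrite px = refl
any-true p (x ∷ xs) (there x∈xs) px with p x
... | true  = refl
... | false = any-true p xs x∈xs px

any-mono : ∀ {p q : 𝕏 → Bool} xs → (∀ x → x ∈ xs → p x ≡ true → q x ≡ true) →
           any p xs ≡ true → any q xs ≡ true
any-mono {p = p} {q} (x ∷ xs) p⇒q h with p x in px
... | true  rewrite p⇒q x (here refl) px = refl
... | false with q x
...   | true  = refl
...   | false = any-mono xs (λ y → p⇒q y ∘ there) h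

𝟙-any : ∀ (p : 𝕏 → Bool) xs → 𝟙 (any p xs) ≤ count p xs
𝟙-any p []       = z≤n
𝟙-any p (x ∷ xs) with p x
... | true  = s≤s z≤n
... | false = 𝟙-any p xs

∑-+₄ : ∀ (xs : List 𝕏) (f g h k : 𝕏 → ℕ) →
       ∑ xs (λ x → f x + (g x + (h x + k x))) ≡ ∑ xs f + (∑ xs g + (∑ xs h + ∑ xs k))
∑-+₄ xs f g h k = trans (∑-+ xs f _) (cong (∑ xs f +_)
  (trans (∑-+ xs g _) (cong (∑ xs g +_) (∑-+ xs h k))))

∈⇒1≤count : ∀ (p : 𝕏 → Bool) {x} xs → x ∈ xs → p x ≡ true → 1 ≤ count p xs
∈⇒1≤count p (x ∷ xs) (here refl)  px rewrite px = s≤s z≤n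
∈⇒1≤count p (x ∷ xs) (there x∈xs) px = ≤-trans (∈⇒1≤count p xs x∈xs px) (m≤n+m _ _)

any-false : ∀ (p : 𝕏 → Bool) xs → (∀ x → x ∈ xs → p x ≡ false) → any p xs ≡ false
any-false p []       h = refl
any-false p (x ∷ xs) h rewrite h x (here refl) = any-false p xs (λ y → h y ∘ there)

≢[]⇒1≤length : ∀ (xs : List 𝕏) → xs ≢ [] → 1 ≤ length xs
≢[]⇒1≤length []      ≢[] = contradiction refl ≢[]
≢[]⇒1≤length (_ ∷ _) _   = s≤s z≤n

-- Families of outcomes

-- Models a branching procedure that learns about an unknown `I`: `P` is what is known beforehand,
-- each outcome ends one branch, and `Fits` is what that branch has learnt about `I`. The bound `n`
-- limits the number of branches.
record Cover (P : Ω → Set) (Fits : Ω → 𝕐 → Set) (Good : 𝕐 → Set) (n : ℕ) : Set where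
  constructor cover
  field
    outcomes : List 𝕐
    size≤    : length outcomes ≤ n
    good     : ∀ b → b ∈ outcomes → Good b
    covers   : ∀ I → P I → ∃ λ b → b ∈ outcomes × Fits I b

module _ {P : Ω → Set} {Fits : Ω → 𝕐 → Set} {Good : 𝕐 → Set} where

  cover-one : ∀ b → Good b → (∀ I → P I → Fits I b) → Cover P Fits Good 1
  cover-one b good fits = cover (b ∷ []) ≤-refl (λ { _ (here refl) → good }) (λ I p → b , here refl , fits I p)

  cover-weaken : ∀ {P′ : Ω → Set} {Good′ : 𝕐 → Set} {m n} → m ≤ n → (∀ I → P′ I → P I) →
                 (∀ b → Good b → Good′ b) → Cover P Fits Good m → Cover P′ Fits Good′ n
  cover-weaken m≤n P′⇒P good⇒ (cover bs l g c) =
    cover bs (≤-trans l m≤n) (λ b → good⇒ b ∘ g b) (λ I → c I ∘ P′⇒P I)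

cover-split : ∀ {P P₁ P₂ : Ω → Set} {Fits : Ω → 𝕐 → Set} {Good : 𝕐 → Set} {m n} →
              (∀ I → P I → P₁ I ⊎ P₂ I) →
              Cover P₁ Fits Good m → Cover P₂ Fits Good n → Cover P Fits Good (m + n)
cover-split {P = P} {Fits = Fits} split (cover bs₁ l₁ g₁ c₁) (cover bs₂ l₂ g₂ c₂) =
  cover (bs₁ ++ bs₂)
        (≤-trans (≤-reflexive (length-++ bs₁)) (+-mono-≤ l₁ l₂))
        (λ b b∈ → [ g₁ b , g₂ b ]′ (∈-++⁻ bs₁ b∈))
        covers
  where
  covers : ∀ I → P I → ∃ λ b → b ∈ bs₁ ++ bs₂ × Fits I b
  covers I p with split I p
  ... | inj₁ p₁ with b , b∈ , f ← c₁ I p₁ = b , ∈-++⁺ˡ b∈ , f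
  ... | inj₂ p₂ with b , b∈ , f ← c₂ I p₂ = b , ∈-++⁺ʳ bs₁ b∈ , f

-- Runs a second procedure from every outcome of the first. It may use both `P I` and what the
-- outcome says about `I`; the branch counts multiply.
cover-bind : ∀ {P : Ω → Set} {Fits : Ω → 𝕐 → Set} {Good : 𝕐 → Set}
               {Fits′ : Ω → 𝕐′ → Set} {Good′ : 𝕐′ → Set} {m n} → Cover P Fits Good m →
             (∀ b → Good b → Cover (λ I → P I × Fits I b) Fits′ Good′ n) →
             Cover P Fits′ Good′ (m * n)
cover-bind {P = P} {Fits} {Good} {Fits′} {Good′} {n = n} (cover bs l g c) next =
  cover-weaken (*-monoˡ-≤ n l) (λ I p → p , c I p) (λ _ → id) (all-of bs g)
  where
  all-of : ∀ bs → (∀ b → b ∈ bs → Good b) →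
           Cover (λ I → P I × ∃ λ b → b ∈ bs × Fits I b) Fits′ Good′ (length bs * n)
  all-of []       g = cover [] z≤n (λ _ ()) (λ { _ (_ , _ , () , _) })
  all-of (b ∷ bs) g =
    cover-split (λ { _ (p , _ , here refl , f)  → inj₁ (p , f)
                   ; _ (p , b , there b∈ , f) → inj₂ (p , b , b∈ , f) })
                (next b (g b (here refl))) (all-of bs (λ b → g b ∘ there))

-- The number of answer patterns of d questions with at most a positive answers.
paths : ℕ → ℕ → ℕ
paths zero    a       = 1
paths (suc d) zero    = 1
paths (suc d) (suc a) = paths d a + paths d (suc a)

1≤paths : ∀ d a → 1 ≤ paths d a
1≤paths zero    a       = ≤-refl
1≤paths (suc d) zero    = ≤-refl
1≤paths (suc d) (suc a) = ≤-trans (1≤paths d a) (m≤m+n _ _)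

paths-mono : ∀ d a → paths d a ≤ paths (suc d) a
paths-mono zero    zero    = ≤-refl
paths-mono (suc d) zero    = ≤-refl
paths-mono d       (suc a) = m≤n+m _ _

-- Booleans and decidable comparison.

∧-true : ∀ {a b} → a ∧ b ≡ true → a ≡ true × b ≡ true
∧-true {true} {true} refl = refl , refl

true-∧ : ∀ {a b} → a ≡ true → b ≡ true → a ∧ b ≡ true
true-∧ refl refl = refl

∨-true : ∀ {a b} → a ∨ b ≡ true → a ≡ true ⊎ b ≡ true
∨-true {true}         refl = inj₁ refl
∨-true {false} {true} refl = inj₂ refl

true-∨ˡ : ∀ {a b} → a ≡ true → a ∨ b ≡ true
true-∨ˡ refl = refl

true-∨ʳ : ∀ {a b} → b ≡ true → a ∨ b ≡ true
true-∨ʳ {true}  refl = refl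
true-∨ʳ {false} refl = refl

not-mono : ∀ {a b} → (a ≡ true → b ≡ true) → not b ≡ true → not a ≡ true
not-mono {false} {false} a⇒b _ = refl
not-mono {true}  {false} a⇒b _ = a⇒b refl

not-true : ∀ {a} → not a ≡ true → a ≡ false
not-true {false} _ = refl

clash : ∀ {a} {Z : Set} → a ≡ true → not a ≡ true → Z
clash {true} _ ()

≤?-true : ∀ {m n} → m ≤ n → does (m ≤? n) ≡ true
≤?-true {m} {n} = dec-true (m ≤? n)

true-≤? : ∀ {m n} → does (m ≤? n) ≡ true → m ≤ n
true-≤? {m} {n} eq = ≤ᵇ⇒≤ m n (subst Data.Bool.T (sym eq) tt)

false-≤? : ∀ {m n} → does (m ≤? n) ≡ false → n < m
false-≤? {m} {n} eq = ≰⇒> λ m≤n → contradiction (trans (sym (≤?-true m≤n)) eq) λ ()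

-- Hypergraphs with ordered edges: coordinates are functions from edges to vertices

module Hypergraph {X : Set} (E : List X) (w : ℕ) where

  Sub Coord VertexSet : Set
  Sub       = X → Bool
  Coord     = X → Fin w
  VertexSet = Fin w → Bool

  ∣_∣ : Sub → ℕ
  ∣ K ∣ = count K E

  _⊆_ : Sub → Sub → Set
  K ⊆ G = ∀ e → K e ≡ true → G e ≡ true

  ∣∣-mono : ∀ {K G} → K ⊆ G → ∣ K ∣ ≤ ∣ G ∣
  ∣∣-mono K⊆G = count-mono E K⊆G

  deg : Coord → Sub → Fin w → ℕ
  deg ρ K u = ∣ (λ e → K e ∧ (ρ e ≡ᵇ u)) ∣

  deg-mono : ∀ ρ {K G} → K ⊆ G → ∀ u → deg ρ K u ≤ deg ρ G u
  deg-mono ρ K⊆G u = ∣∣-mono (λ e h → let k , r = ∧-true h in true-∧ (K⊆G e k) r)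

  -- Double counting: an edge is found only at the vertex `ρ e`.
  ∑-deg : ∀ ρ K (P : VertexSet) →
          ∑ (allFin w) (λ u → 𝟙 (P u) * deg ρ K u) ≡ ∣ (λ e → K e ∧ P (ρ e)) ∣
  ∑-deg ρ K P = begin
    ∑ (allFin w) (λ u → 𝟙 (P u) * deg ρ K u)
      ≡⟨ ∑-cong (allFin w) (λ u → ∑-* (𝟙 (P u)) E _) ⟩
    ∑ (allFin w) (λ u → ∑ E (λ e → 𝟙 (P u) * 𝟙 (K e ∧ (ρ e ≡ᵇ u))))
      ≡⟨ ∑-swap (allFin w) E _ ⟩
    ∑ E (λ e → ∑ (allFin w) (λ u → 𝟙 (P u) * 𝟙 (K e ∧ (ρ e ≡ᵇ u))))
      ≡⟨ ∑-cong E (λ e → ∑-cong (allFin w) (λ u → reorder (P u) (K e) (ρ e ≡ᵇ u))) ⟩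
    ∑ E (λ e → ∑ (allFin w) (λ u → 𝟙 (ρ e ≡ᵇ u) * 𝟙 (K e ∧ P u)))
      ≡⟨ ∑-cong E (λ e → ∑-δ (ρ e) (λ u → 𝟙 (K e ∧ P u))) ⟩
    ∣ (λ e → K e ∧ P (ρ e)) ∣ ∎
    where
    open ≡-Reasoning
    reorder : ∀ a b c → 𝟙 a * 𝟙 (b ∧ c) ≡ 𝟙 c * 𝟙 (b ∧ a)
    reorder true  true  true  = refl
    reorder true  true  false = refl
    reorder true  false true  = refl
    reorder true  false false = refl
    reorder false true  true  = refl
    reorder false true  false = refl
    reorder false false true  = refl
    reorder false false false = refl

  ∑-deg-all : ∀ ρ K → ∑ (allFin w) (deg ρ K) ≡ ∣ K ∣
  ∑-deg-all ρ K = begin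
    ∑ (allFin w) (deg ρ K)                  ≡⟨ ∑-cong (allFin w) (λ u → +-identityʳ (deg ρ K u)) ⟨
    ∑ (allFin w) (λ u → 1 * deg ρ K u)      ≡⟨ ∑-deg ρ K (λ _ → true) ⟩
    ∣ (λ e → K e ∧ true) ∣                  ≡⟨ ∑-cong E (λ e → cong 𝟙 (∧-true-id (K e))) ⟩
    ∣ K ∣ ∎
    where
    open ≡-Reasoning
    ∧-true-id : ∀ a → a ∧ true ≡ a
    ∧-true-id true  = refl
    ∧-true-id false = refl

  -- The error C * L arises because collecting the edges at one vertex raises degrees by up to L.
  Capped : (L C : ℕ) (K G : Sub) → List Coord → Set
  Capped L C K G ρs = ∀ ρ → ρ ∈ ρs → ∀ u → C * deg ρ K u ≤ deg ρ G u + C * L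

  Codegree≤ : (L : ℕ) → Sub → Coord → Coord → Set
  Codegree≤ L G π ρ = ∀ y u → ∣ (λ e → G e ∧ ((π e ≡ᵇ y) ∧ (ρ e ≡ᵇ u))) ∣ ≤ L

  -- Summing the cap over the vertices in `P` turns degrees into edge counts; the error `C * L` is
  -- paid at most once for each of the `w` vertices.
  capped-count : ∀ {L C K G ρs} → Capped L C K G ρs → ∀ {ρ} → ρ ∈ ρs → (P : VertexSet) →
                 C * ∣ (λ e → K e ∧ P (ρ e)) ∣ ≤ ∣ (λ e → G e ∧ P (ρ e)) ∣ + w * (C * L)
  capped-count {L} {C} {K} {G} capped {ρ} ρ∈ P = begin
    C * ∣ (λ e → K e ∧ P (ρ e)) ∣
      ≡⟨ cong (C *_) (∑-deg ρ K P) ⟨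
    C * ∑ (allFin w) (λ u → 𝟙 (P u) * deg ρ K u)
      ≡⟨ ∑-* C (allFin w) _ ⟩
    ∑ (allFin w) (λ u → C * (𝟙 (P u) * deg ρ K u))
      ≤⟨ ∑-mono (allFin w) (λ u → bound (P u) (capped ρ ρ∈ u)) ⟩
    ∑ (allFin w) (λ u → 𝟙 (P u) * deg ρ G u + C * L)
      ≡⟨ ∑-+ (allFin w) _ _ ⟩
    ∑ (allFin w) (λ u → 𝟙 (P u) * deg ρ G u) + ∑ (allFin w) (λ _ → C * L)
      ≡⟨ cong₂ _+_ (∑-deg ρ G P) (∑-allFin-const w (C * L)) ⟩
    ∣ (λ e → G e ∧ P (ρ e)) ∣ + w * (C * L) ∎
    where
    open ≤-Reasoning
    bound : ∀ b {d d′} → C * d ≤ d′ + C * L → C * (𝟙 b * d) ≤ 𝟙 b * d′ + C * L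
    bound true {d} {d′} h = begin
      C * (1 * d)    ≡⟨ cong (C *_) (*-identityˡ d) ⟩
      C * d          ≤⟨ h ⟩
      d′ + C * L     ≡⟨ cong (_+ C * L) (*-identityˡ d′) ⟨
      1 * d′ + C * L ∎
    bound false h = ≤-trans (≤-reflexive (*-zeroʳ C)) z≤n

  capped-total : ∀ {L C K G ρs} → Capped L C K G ρs → ∀ {ρ} → ρ ∈ ρs →
                 C * ∣ K ∣ ≤ ∣ G ∣ + w * (C * L)
  capped-total {L} {C} {K} {G} capped {ρ} ρ∈ =
    ≤-trans (*-monoʳ-≤ C (∣∣-mono {K} {λ e → K e ∧ true} (λ e k → true-∧ k refl)))
    (≤-trans (capped-count {L} {C} {K} {G} capped ρ∈ (λ _ → true))
             (+-monoˡ-≤ _ (∣∣-mono {λ e → G e ∧ true} {G} (λ e → proj₁ ∘ ∧-true))))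

  -- Scanning all vertices at one coordinate.

  module Scan (L m : ℕ) (G K : Sub) (π : Coord) (πs : List Coord) (C β : ℕ)
              (K⊆G : K ⊆ G) (codeg : ∀ ρ → ρ ∈ πs → Codegree≤ L G π ρ)
              (bounded : ∀ K′ → Capped L C K′ G πs → C * ∣ K′ ∣ ≤ 2 * m) where

    saturatedAt : Sub → Coord → VertexSet
    saturatedAt K′ ρ u = does (deg ρ G u ≤? C * deg ρ K′ u)

    saturated : Sub → Sub
    saturated K′ e = any (λ ρ → saturatedAt K′ ρ (ρ e)) πs

    fresh : Sub → Sub
    fresh K′ e = K e ∧ not (K′ e ∨ saturated K′ e)

    fresh-at : Sub → Fin w → Sub
    fresh-at K′ y e = fresh K′ e ∧ (π e ≡ᵇ y)

    extend : Sub → Fin w → Sub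
    extend K′ y e = K′ e ∨ fresh-at K′ y e

    -- Collecting more edges only saturates more vertices. Hence a vertex with few fresh edges at
    -- its turn still has few at the end of the scan.
    fresh-antitone : ∀ {K′ K″} → K′ ⊆ K″ → fresh K″ ⊆ fresh K′
    fresh-antitone {K′} {K″} K′⊆K″ e h with k , n ← ∧-true h =
      true-∧ k (not-mono step n)
      where
      step : K′ e ∨ saturated K′ e ≡ true → K″ e ∨ saturated K″ e ≡ true
      step h with ∨-true h
      ... | inj₁ k′ = true-∨ˡ (K′⊆K″ e k′)
      ... | inj₂ s  = true-∨ʳ (any-mono πs
              (λ ρ _ t → ≤?-true (≤-trans (true-≤? {deg ρ G (ρ e)} t)
                                    (*-monoʳ-≤ C (deg-mono ρ K′⊆K″ (ρ e))))) s)

    ∣extend∣ : ∀ K′ y → ∣ extend K′ y ∣ ≡ ∣ K′ ∣ + deg π (fresh K′) y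
    ∣extend∣ K′ y = trans (∑-cong E (λ e → disjoint (K′ e) (K e) (saturated K′ e) (π e ≡ᵇ y)))
                          (∑-+ E _ _)
      where
      disjoint : ∀ a k s p → 𝟙 (a ∨ ((k ∧ not (a ∨ s)) ∧ p)) ≡ 𝟙 a + 𝟙 ((k ∧ not (a ∨ s)) ∧ p)
      disjoint true  true  s p = refl
      disjoint true  false s p = refl
      disjoint false k     s p = refl

    -- At a saturated vertex no fresh edge is added, so its degree is unchanged. At any other vertex
    -- `u` the old degree obeys the cap without error, and the added edges all pass through `y` and
    -- `u`, so there are at most `L` of them.
    extend-capped : ∀ {K′} y → Capped L C K′ G πs → Capped L C (extend K′ y) G πs
    extend-capped {K′} y capped ρ ρ∈ u with saturatedAt K′ ρ u in eq
    ... | true = ≤-trans (*-monoʳ-≤ C (∣∣-mono unchanged)) (capped ρ ρ∈ u)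
      where
      unchanged : (λ e → extend K′ y e ∧ (ρ e ≡ᵇ u)) ⊆ (λ e → K′ e ∧ (ρ e ≡ᵇ u))
      unchanged e h with x , ρe≡u ← ∧-true h with ∨-true x
      ... | inj₁ k′ = true-∧ k′ ρe≡u
      ... | inj₂ g with f , _ ← ∧-true {fresh K′ e} g with k , n ← ∧-true {K e} f with refl ← ≡ᵇ-sound (ρ e) u ρe≡u =
        clash (true-∨ʳ {K′ e} (any-true (λ ρ → saturatedAt K′ ρ (ρ e)) πs ρ∈ eq)) n
    ... | false = begin
      C * deg ρ (extend K′ y) u                     ≤⟨ *-monoʳ-≤ C grow ⟩
      C * (deg ρ K′ u + L)                          ≡⟨ *-distribˡ-+ C (deg ρ K′ u) L ⟩
      C * deg ρ K′ u + C * L                        ≤⟨ +-monoˡ-≤ (C * L) unsaturated ⟩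
      deg ρ G u + C * L ∎
      where
      open ≤-Reasoning
      unsaturated : C * deg ρ K′ u ≤ deg ρ G u
      unsaturated = <⇒≤ (false-≤? {deg ρ G u} eq)
      split : ∀ a g p → 𝟙 ((a ∨ g) ∧ p) ≤ 𝟙 (a ∧ p) + 𝟙 (g ∧ p)
      split true  g p = m≤m+n _ _
      split false g p = ≤-refl
      grow : deg ρ (extend K′ y) u ≤ deg ρ K′ u + L
      grow = begin
        deg ρ (extend K′ y) u
          ≤⟨ ∑-mono E (λ e → split (K′ e) (fresh-at K′ y e) (ρ e ≡ᵇ u)) ⟩
        ∑ E (λ e → 𝟙 (K′ e ∧ (ρ e ≡ᵇ u)) + 𝟙 (fresh-at K′ y e ∧ (ρ e ≡ᵇ u)))
          ≡⟨ ∑-+ E _ _ ⟩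
        deg ρ K′ u + ∣ (λ e → fresh-at K′ y e ∧ (ρ e ≡ᵇ u)) ∣
          ≤⟨ +-monoʳ-≤ (deg ρ K′ u) (≤-trans (∣∣-mono inG) (codeg ρ ρ∈ y u)) ⟩
        deg ρ K′ u + L ∎
        where
        inG : (λ e → fresh-at K′ y e ∧ (ρ e ≡ᵇ u)) ⊆ (λ e → G e ∧ ((π e ≡ᵇ y) ∧ (ρ e ≡ᵇ u)))
        inG e h with g , r ← ∧-true h with f , p ← ∧-true g with k , _ ← ∧-true f =
          true-∧ (K⊆G e k) (true-∧ p r)

    State : Set
    State = Sub × VertexSet

    Fits : VertexSet → State → Set
    Fits I (K′ , D) = (∀ e → K′ e ≡ true → I (π e) ≡ true) × (∀ y → D y ≡ true → I y ≡ false)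

    -- A marked vertex is exempt: it is already known to lie outside `I`, however many fresh edges
    -- it has.
    Exhausted : State → Fin w → Set
    Exhausted (K′ , D) y = D y ≡ false → β * deg π (fresh K′) y ≤ m

    record Scanned (K₀ : Sub) (D₀ : VertexSet) (ys : List (Fin w)) (S : State) : Set where
      field
        K₀⊆       : K₀ ⊆ proj₁ S
        D₀⊆       : ∀ y → D₀ y ≡ true → proj₂ S y ≡ true
        capped    : Capped L C (proj₁ S) G πs
        ⊆K        : proj₁ S ⊆ K
        exhausted : ∀ y → y ∈ ys → Exhausted S y

    scanned-∷ : ∀ {K₀ K₁ D₀ D₁ y ys S} → K₀ ⊆ K₁ → (∀ z → D₀ z ≡ true → D₁ z ≡ true) →
                Exhausted (K₁ , D₁) y → Scanned K₁ D₁ ys S → Scanned K₀ D₀ (y ∷ ys) S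
    scanned-∷ {K₁ = K₁} {D₁ = D₁} {y} {S = K″ , D″} K₀⊆K₁ D₀⊆D₁ ex sc = record
      { K₀⊆       = λ e → S.K₀⊆ e ∘ K₀⊆K₁ e
      ; D₀⊆       = λ z → S.D₀⊆ z ∘ D₀⊆D₁ z
      ; capped    = S.capped
      ; ⊆K        = S.⊆K
      ; exhausted = λ { _ (here refl) → head ; z (there z∈) → S.exhausted z z∈ } }
      where
      module S = Scanned sc
      head : Exhausted (K″ , D″) y
      head D″y with D₁ y in eq
      ... | true  with () ← trans (sym (S.D₀⊆ y eq)) D″y
      ... | false = ≤-trans (*-monoʳ-≤ β (deg-mono π (fresh-antitone S.K₀⊆) y)) (ex refl)

    mark : VertexSet → Fin w → VertexSet
    mark D y z = D z ∨ (y ≡ᵇ z)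

    -- The last inequality guards the budget `a` of positive answers. A question is asked only if at
    -- least `m / β` fresh edges sit at `y`, so a positive answer raises `β * (C * ∣ K′ ∣)` by at
    -- least `C * m`, which pays for the lost unit of budget.
    scan : ∀ ys K′ D a → Capped L C K′ G πs → K′ ⊆ K →
           2 * m * β < β * (C * ∣ K′ ∣) + a * (C * m) →
           Cover (λ I → Fits I (K′ , D)) Fits (Scanned K′ D ys) (paths (length ys) a)
    scan [] K′ D a capped K′⊆K fuel =
      cover-one (K′ , D)
        (record { K₀⊆ = λ _ → id ; D₀⊆ = λ _ → id ; capped = capped ; ⊆K = K′⊆K ; exhausted = λ _ () })
        (λ _ → id)
    scan (y ∷ ys) K′ D a capped K′⊆K fuel with m ≤? β * deg π (fresh K′) y
    ... | no m≰ =
      cover-weaken (paths-mono (length ys) a) (λ _ → id)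
        (λ S → scanned-∷ {S = S} (λ _ → id) (λ _ → id) (λ _ → <⇒≤ (≰⇒> m≰)))
        (scan ys K′ D a capped K′⊆K fuel)
    -- With the budget spent, `fuel` contradicts `bounded`, so no question can arise here.
    scan (y ∷ ys) K′ D zero capped K′⊆K fuel | yes m≤ = contradiction fuel (≤⇒≯ (begin
      β * (C * ∣ K′ ∣) + 0 ≡⟨ +-identityʳ _ ⟩
      β * (C * ∣ K′ ∣)     ≤⟨ *-monoʳ-≤ β (bounded K′ capped) ⟩
      β * (2 * m)          ≡⟨ *-comm β (2 * m) ⟩
      2 * m * β ∎))
      where open ≤-Reasoning
    scan (y ∷ ys) K′ D (suc a) capped K′⊆K fuel | yes m≤ =
      -- First branch: `y` lies in `I` and its fresh edges are collected. Second branch: `y` lies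
      -- outside `I` and is marked.
      cover-split split
        (cover-weaken ≤-refl (λ _ → id)
          (λ S → scanned-∷ {S = S} (λ e → true-∨ˡ) (λ _ → id) (λ _ → emptied))
          (scan ys K₁ D a (extend-capped y capped) K₁⊆K fuel₁))
        (cover-weaken ≤-refl (λ _ → id)
          (λ S → scanned-∷ {S = S} (λ _ → id) (λ z → true-∨ˡ) marked)
          (scan ys K′ (mark D y) (suc a) capped K′⊆K fuel))
      where
      K₁ = extend K′ y
      g  = deg π (fresh K′) y
      K₁⊆K : K₁ ⊆ K
      K₁⊆K e h with ∨-true h
      ... | inj₁ k′ = K′⊆K e k′
      ... | inj₂ f = proj₁ (∧-true (proj₁ (∧-true f)))
      -- An edge fresh for `K₁` was fresh for `K′`; at `y` it would have been collected into `K₁`.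
      emptied : β * deg π (fresh K₁) y ≤ m
      emptied = ≤-trans (≤-reflexive (trans (cong (β *_) (count-false E none)) (*-zeroʳ β))) z≤n
        where
        none : ∀ e → fresh-at K₁ y e ≡ true → false ≡ true
        none e h with f , p ← ∧-true h with k , n ← ∧-true f =
          clash (true-∨ˡ {K₁ e} (true-∨ʳ {K′ e}
                  (true-∧ (fresh-antitone {K′} {K₁} (λ e → true-∨ˡ) e f) p))) n
      marked : Exhausted (K′ , mark D y) y
      marked eq with () ← trans (sym (true-∨ʳ {D y} (≡ᵇ-refl y))) eq
      fuel₁ : 2 * m * β < β * (C * ∣ K₁ ∣) + a * (C * m)
      fuel₁ = begin-strict
        2 * m * β                                         <⟨ fuel ⟩
        β * (C * ∣ K′ ∣) + (C * m + a * (C * m))          ≤⟨ +-monoʳ-≤ (β * (C * ∣ K′ ∣)) (+-monoˡ-≤ _ (*-monoʳ-≤ C m≤)) ⟩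
        β * (C * ∣ K′ ∣) + (C * (β * g) + a * (C * m))    ≡⟨ regroup β C ∣ K′ ∣ g (a * (C * m)) ⟩
        β * (C * (∣ K′ ∣ + g)) + a * (C * m)              ≡⟨ cong (λ x → β * (C * x) + a * (C * m)) (∣extend∣ K′ y) ⟨
        β * (C * ∣ K₁ ∣) + a * (C * m) ∎
        where
        open ≤-Reasoning
        regroup : ∀ b c x g t → b * (c * x) + (c * (b * g) + t) ≡ b * (c * (x + g)) + t
        regroup = solve-∀
      split : ∀ I → Fits I (K′ , D) → Fits I (K₁ , D) ⊎ Fits I (K′ , mark D y)
      split I (yes′ , no′) with I y in eq
      ... | true = inj₁ (yes₁ , no′)
        where
        yes₁ : ∀ e → K₁ e ≡ true → I (π e) ≡ true
        yes₁ e h with ∨-true h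
        ... | inj₁ k′ = yes′ e k′
        ... | inj₂ f with refl ← ≡ᵇ-sound (π e) y (proj₂ (∧-true f)) = eq
      ... | false = inj₂ (yes′ , no₁)
        where
        no₁ : ∀ z → mark D y z ≡ true → I z ≡ false
        no₁ z h with ∨-true h
        ... | inj₁ d = no′ z d
        ... | inj₂ y≡z with refl ← ≡ᵇ-sound y z y≡z = eq

-- Arithmetic and parameters of the induction on coordinates.

many-touched : ∀ ℓ A {m C C′ k k′ sat tk low t W} →
  m ≤ C * A * k → k ≤ sat + (k′ + (tk + low)) →
  C * sat ≤ ℓ * (C′ * k′ + W) → C * tk ≤ t + W → 8 * A * C * low ≤ m →
  C ≤ C′ → 8 * suc ℓ * A * (C′ * k′) ≤ m → 8 * suc ℓ * A * W ≤ m →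
  m ≤ 8 * A * t
many-touched ℓ A {m} {C} {C′} {k} {k′} {sat} {tk} {low} {t} {W} dense k≤ sat≤ tk≤ low≤ C≤C′ k′≤ W≤ =
  -- Eight times `dense`, with `k` split into its four classes, gives 8m on the left. Collected and
  -- saturated edges, the error `W` and the class `low` cost at most m each, so 5m remains for the
  -- touched edges.
  ≤-trans (m≤m+n m (4 * m)) (+-cancelʳ-≤ (3 * m) (m + 4 * m) (8 * A * t) (begin
    m + 4 * m + 3 * m
      ≡⟨ eight m ⟩
    8 * m
      ≤⟨ *-monoʳ-≤ 8 dense ⟩
    8 * (C * A * k)
      ≤⟨ *-monoʳ-≤ 8 (*-monoʳ-≤ (C * A) k≤) ⟩
    8 * (C * A * (sat + (k′ + (tk + low))))
      ≡⟨ expand A C sat k′ tk low ⟩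
    8 * A * (C * sat + C * k′ + C * tk) + 8 * A * C * low
      ≤⟨ +-mono-≤ (*-monoʳ-≤ (8 * A) (+-mono-≤ (+-mono-≤ sat≤ (*-monoˡ-≤ k′ C≤C′)) tk≤)) low≤ ⟩
    8 * A * (ℓ * (C′ * k′ + W) + C′ * k′ + (t + W)) + m
      ≡⟨ collect A ℓ (C′ * k′) W t m ⟩
    8 * A * t + (8 * suc ℓ * A * (C′ * k′) + 8 * suc ℓ * A * W + m)
      ≤⟨ +-monoʳ-≤ (8 * A * t) (+-monoˡ-≤ m (+-mono-≤ k′≤ W≤)) ⟩
    8 * A * t + (m + m + m)
      ≡⟨ cong (8 * A * t +_) (three m) ⟩
    8 * A * t + 3 * m ∎))
  where
  open ≤-Reasoning
  eight : ∀ m → m + 4 * m + 3 * m ≡ 8 * m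
  eight = solve-∀
  three : ∀ m → m + m + m ≡ 3 * m
  three = solve-∀
  expand : ∀ A C s k t l → 8 * (C * A * (s + (k + (t + l)))) ≡
           8 * A * (C * s + C * k + C * t) + 8 * A * C * l
  expand = solve-∀
  collect : ∀ A ℓ x W t m → 8 * A * (ℓ * (x + W) + x + (t + W)) + m ≡
            8 * A * t + (8 * suc ℓ * A * x + 8 * suc ℓ * A * W + m)
  collect = solve-∀

-- A set `K` with cap ratio `C` counts as dense if `m ≤ C * A * ∣ K ∣`. The new `A` is so large that
-- a set failing the next density test costs at most m in `many-touched`.
nextA : ℕ → ℕ → ℕ
nextA ℓ A = 8 * suc ℓ * A

-- Makes `a` positive answers enough for a scan with threshold `8 * A * C * w`: each answer earns
-- `nextC T A C * m`, and `w < a * T`.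
nextC : (T A C : ℕ) → ℕ
nextC T A C = 2 * (8 * A * C) * T

-- The reciprocal of the proportion of edges that the excluded set is sure to meet. The sum
-- dominates the factor of every coordinate at which the procedure may stop; it involves neither `T`
-- nor `C`.
touchFactor : ℕ → ℕ → ℕ
touchFactor zero    A = 8 * A
touchFactor (suc ℓ) A = 8 * A + touchFactor ℓ (nextA (suc ℓ) A)

-- Adds up the coefficients of `L * w` in the error terms of all later coordinates, so that one
-- inequality at the outset serves throughout.
sparseness : (T ℓ A C : ℕ) → ℕ
sparseness T zero    A C = 8 * A * C
sparseness T (suc ℓ) A C =
  nextA (suc ℓ) A * C + nextC T A C + sparseness T ℓ (nextA (suc ℓ) A) (nextC T A C)

-- Excluded vertex sets for a hypergraph with small codegrees.

module Containers {X : Set} (E : List X) (w m L T a : ℕ)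
                  (1≤w : 1 ≤ w) (1≤m : 1 ≤ m) (1≤T : 1 ≤ T) (w<aT : w < a * T) where

  open Hypergraph E w

  Avoids : VertexSet → VertexSet → Set
  Avoids I D = ∀ y → D y ≡ true → I y ≡ false

  -- Only the coordinates in `ρs` are still candidates for lying outside `I`; those treated before
  -- are known to lie inside.
  Independent : Sub → List Coord → VertexSet → Set
  Independent K ρs I = ∀ e → e ∈ E → K e ≡ true → Any (λ ρ → I (ρ e) ≡ false) ρs

  Touched : ℕ → Sub → List Coord → VertexSet → Set
  Touched z G ρs D = Any (λ ρ → m ≤ z * ∣ (λ e → G e ∧ D (ρ e)) ∣) ρs

  module Dichotomy (G K : Sub) (π : Coord) (πs : List Coord) (A C : ℕ)
                   (1≤A : 1 ≤ A) (1≤C : 1 ≤ C) (K⊆G : K ⊆ G)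
                   (capped : Capped L C K G (π ∷ πs))
                   (codeg : ∀ ρ → ρ ∈ πs → Codegree≤ L G π ρ)
                   (dense : m ≤ C * A * ∣ K ∣)
                   (bounded : ∀ K′ → Capped L (nextC T A C) K′ G πs →
                              nextC T A C * ∣ K′ ∣ ≤ 2 * m)
                   (C≤C′ : C ≤ nextC T A C)
                   (sparse : nextA (length πs) A * (w * (C * L)) ≤ m) where

    ℓ B C′ : ℕ
    ℓ  = length πs
    B  = 8 * A * C
    C′ = nextC T A C

    open Scan L m G K π πs C′ (B * w) K⊆G codeg bounded

    -- An edge saturated at `ρ` meets a vertex whose `G`-degree is at most `C′` times its
    -- `K′`-degree. The cap on `K` leads to `G`-degrees, and over these vertices they add up to at
    -- most `C′ * ∣ K′ ∣`, once for each of the `ℓ` later coordinates.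
    saturated-few : ∀ K′ → C * ∣ (λ e → K e ∧ saturated K′ e) ∣ ≤ ℓ * (C′ * ∣ K′ ∣ + w * (C * L))
    saturated-few K′ = begin
      C * ∣ (λ e → K e ∧ saturated K′ e) ∣
        ≤⟨ *-monoʳ-≤ C (∑-mono E (λ e → spread (K e) (λ ρ → saturatedAt K′ ρ (ρ e)))) ⟩
      C * ∑ E (λ e → ∑ πs (λ ρ → 𝟙 (K e ∧ saturatedAt K′ ρ (ρ e))))
        ≡⟨ cong (C *_) (∑-swap E πs _) ⟩
      C * ∑ πs (λ ρ → ∣ (λ e → K e ∧ saturatedAt K′ ρ (ρ e)) ∣)
        ≡⟨ ∑-* C πs _ ⟩
      ∑ πs (λ ρ → C * ∣ (λ e → K e ∧ saturatedAt K′ ρ (ρ e)) ∣)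
        ≤⟨ ∑-mono-∈ πs bound ⟩
      ∑ πs (λ _ → C′ * ∣ K′ ∣ + w * (C * L))
        ≡⟨ ∑-const πs _ ⟩
      ℓ * (C′ * ∣ K′ ∣ + w * (C * L)) ∎
      where
      open ≤-Reasoning
      spread : ∀ k p → 𝟙 (k ∧ any p πs) ≤ ∑ πs (λ ρ → 𝟙 (k ∧ p ρ))
      spread true  p = 𝟙-any p πs
      spread false p = z≤n
      bound : ∀ ρ → ρ ∈ πs → C * ∣ (λ e → K e ∧ saturatedAt K′ ρ (ρ e)) ∣ ≤ C′ * ∣ K′ ∣ + w * (C * L)
      bound ρ ρ∈ = begin
        C * ∣ (λ e → K e ∧ saturatedAt K′ ρ (ρ e)) ∣
          ≤⟨ capped-count {L} {C} {K} {G} capped (there ρ∈) (saturatedAt K′ ρ) ⟩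
        ∣ (λ e → G e ∧ saturatedAt K′ ρ (ρ e)) ∣ + w * (C * L)
          ≡⟨ cong (_+ w * (C * L)) (∑-deg ρ G (saturatedAt K′ ρ)) ⟨
        ∑ (allFin w) (λ u → 𝟙 (saturatedAt K′ ρ u) * deg ρ G u) + w * (C * L)
          ≤⟨ +-monoˡ-≤ _ (∑-mono (allFin w) (λ u → 𝟙-* (saturatedAt K′ ρ u) (true-≤? {deg ρ G u}))) ⟩
        ∑ (allFin w) (λ u → C′ * deg ρ K′ u) + w * (C * L)
          ≡⟨ cong (_+ w * (C * L)) (∑-* C′ (allFin w) (deg ρ K′)) ⟨
        C′ * ∑ (allFin w) (deg ρ K′) + w * (C * L)
          ≡⟨ cong (λ x → C′ * x + w * (C * L)) (∑-deg-all ρ K′) ⟩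
        C′ * ∣ K′ ∣ + w * (C * L) ∎

    -- Each unmarked vertex has at most `m / (B * w)` fresh edges, and there are `w` vertices.
    unmarked-few : ∀ {K′ D} → (∀ y → Exhausted (K′ , D) y) →
                   8 * A * C * ∣ (λ e → fresh K′ e ∧ not (D (π e))) ∣ ≤ m
    unmarked-few {K′} {D} exhausted = *-cancelˡ-≤ w {{>-nonZero 1≤w}} (begin
      w * (B * ∣ (λ e → fresh K′ e ∧ not (D (π e))) ∣)
        ≡⟨ rotate w B _ ⟩
      B * w * ∣ (λ e → fresh K′ e ∧ not (D (π e))) ∣
        ≡⟨ cong (B * w *_) (∑-deg π (fresh K′) (not ∘ D)) ⟨
      B * w * ∑ (allFin w) (λ y → 𝟙 (not (D y)) * deg π (fresh K′) y)
        ≡⟨ ∑-* (B * w) (allFin w) _ ⟩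
      ∑ (allFin w) (λ y → B * w * (𝟙 (not (D y)) * deg π (fresh K′) y))
        ≤⟨ ∑-mono (allFin w) (λ y → bound (D y) (exhausted y)) ⟩
      ∑ (allFin w) (λ _ → m)
        ≡⟨ ∑-allFin-const w m ⟩
      w * m ∎)
      where
      open ≤-Reasoning
      rotate : ∀ x y z → x * (y * z) ≡ y * x * z
      rotate = solve-∀
      bound : ∀ b {x} → (b ≡ false → B * w * x ≤ m) → B * w * (𝟙 (not b) * x) ≤ m
      bound true  _ = ≤-trans (≤-reflexive (*-zeroʳ (B * w))) z≤n
      bound false {x} h = ≤-trans (≤-reflexive (cong (B * w *_) (*-identityˡ x))) (h refl)

    -- Every edge of `K` is saturated, collected, at a marked vertex, or fresh at an unmarked one.
    -- If few edges were collected, the saturated and the unmarked class are small too, which leaves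
    -- the marked one.
    marked-many : ∀ {K′ D} → (∀ y → Exhausted (K′ , D) y) → C′ * nextA ℓ A * ∣ K′ ∣ ≤ m →
                  m ≤ 8 * A * ∣ (λ e → G e ∧ D (π e)) ∣
    marked-many {K′} {D} exhausted few =
      many-touched ℓ A {C = C} {C′} dense partition (saturated-few K′)
        (capped-count {L} {C} {K} {G} capped (here refl) D) (unmarked-few exhausted) C≤C′
        (≤-trans (≤-reflexive (shuffle (nextA ℓ A) C′ ∣ K′ ∣)) few) sparse
      where
      shuffle : ∀ x y z → x * (y * z) ≡ y * x * z
      shuffle = solve-∀
      cases : ∀ k k′ s d → 𝟙 k ≤ 𝟙 (k ∧ s) + (𝟙 k′ + (𝟙 (k ∧ d) + 𝟙 ((k ∧ not (k′ ∨ s)) ∧ not d)))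
      cases false k′    s     d     = z≤n
      cases true  k′    true  d     = s≤s z≤n
      cases true  true  false d     = s≤s z≤n
      cases true  false false true  = s≤s z≤n
      cases true  false false false = s≤s z≤n
      partition : ∣ K ∣ ≤ ∣ (λ e → K e ∧ saturated K′ e) ∣ + (∣ K′ ∣ +
                          (∣ (λ e → K e ∧ D (π e)) ∣ + ∣ (λ e → fresh K′ e ∧ not (D (π e))) ∣))
      partition = ≤-trans (∑-mono E (λ e → cases (K e) (K′ e) (saturated K′ e) (D (π e))))
        (≤-reflexive (∑-+₄ E (λ e → 𝟙 (K e ∧ saturated K′ e)) (𝟙 ∘ K′) (λ e → 𝟙 (K e ∧ D (π e))) _))

    scan-all : Cover (λ _ → ⊤) Fits (Scanned (λ _ → false) (λ _ → false) (allFin w)) (paths w a)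
    scan-all = cover-weaken (≤-reflexive (cong (λ d → paths d a) (length-tabulate {n = w} id)))
      (λ _ _ → (λ _ ()) , (λ _ ())) (λ _ → id)
      (scan (allFin w) (λ _ → false) (λ _ → false) a empty-capped (λ _ ()) fuel)
      where
      ∅ : Sub
      ∅ _ = false
      empty-capped : Capped L C′ ∅ G πs
      empty-capped ρ _ u = ≤-trans (≤-reflexive (trans (cong (C′ *_) (∑-zero E)) (*-zeroʳ C′))) z≤n
      -- As `C′ = 2 * B * T`, this is `w < a * T` multiplied by `2 * B * m`.
      fuel : 2 * m * (B * w) < B * w * (C′ * ∣ ∅ ∣) + a * (C′ * m)
      fuel = begin-strict
        2 * m * (B * w)               ≡⟨ left m B w ⟩
        2 * B * m * w                 <⟨ *-monoʳ-< (2 * B * m) {{>-nonZero pos}} w<aT ⟩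
        2 * B * m * (a * T)           ≡⟨ right B m a T ⟩
        a * (C′ * m)                  ≤⟨ m≤n+m _ _ ⟩
        B * w * (C′ * ∣ ∅ ∣) + a * (C′ * m) ∎
        where
        open ≤-Reasoning
        pos : 1 ≤ 2 * B * m
        pos = *-mono-≤ {1} {2 * B} {1} {m}
                (*-mono-≤ {1} {2} (s≤s z≤n) (*-mono-≤ {1} {8 * A} (*-mono-≤ {1} {8} (s≤s z≤n) 1≤A) 1≤C)) 1≤m
        left : ∀ m B w → 2 * m * (B * w) ≡ 2 * B * m * w
        left = solve-∀
        right : ∀ B m a T → 2 * B * m * (a * T) ≡ a * (2 * B * T * m)
        right = solve-∀

  Container : ℕ → Sub → Sub → List Coord → ℕ → Set
  Container z G K ρs n = Cover (Independent K ρs) Avoids (Touched z G ρs) n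

  -- Induction on the remaining coordinates. If the scan at `π` collects densely, `K′` passes to the
  -- next coordinate; otherwise the marked vertices already meet enough edges. Every coordinate but
  -- the last costs at most one scan, hence the exponent `length πs`.
  shrink : ∀ π πs G K A C → 1 ≤ A → 1 ≤ C → K ⊆ G → ∣ G ∣ ≤ m → Capped L C K G (π ∷ πs) →
           AllPairs (Codegree≤ L G) (π ∷ πs) → m ≤ C * A * ∣ K ∣ →
           sparseness T (length πs) A C * (L * w) ≤ m →
           Container (touchFactor (length πs) A) G K (π ∷ πs) (paths w a ^ length πs)
  shrink π [] G K A C 1≤A 1≤C K⊆G G≤m capped _ dense sparse =
    cover-one D (here touched) avoids
    where
    -- At the last coordinate an edge of `K` has no other place to leave `I`, so every vertex that
    -- it meets is outside `I`.
    D : VertexSet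
    D u = does (1 ≤? deg π K u)
    avoids : ∀ I → Independent K (π ∷ []) I → Avoids I D
    avoids I ind y Dy with count-witness _ E (true-≤? {1} {deg π K y} Dy)
    ... | e , e∈E , h with k , p ← ∧-true h with ≡ᵇ-sound (π e) y p | ind e e∈E k
    ... | refl | here Iy≡false = Iy≡false
    marked : ∀ e → e ∈ E → 𝟙 (K e) ≤ 𝟙 (K e ∧ D (π e))
    marked e e∈E = 𝟙-mono λ k → true-∧ k (≤?-true
      (∈⇒1≤count (λ e′ → K e′ ∧ (π e′ ≡ᵇ π e)) E e∈E (true-∧ k (≡ᵇ-refl (π e)))))
    touched : m ≤ 8 * A * ∣ (λ e → G e ∧ D (π e)) ∣
    touched = many-touched 0 A {C = C} {C} {k′ = 0} {sat = 0} {low = 0} dense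
      (≤-trans (∑-mono-∈ E marked) (≤-reflexive (sym (+-identityʳ _))))
      (≤-reflexive (*-zeroʳ C)) (capped-count {L} {C} {K} {G} capped (here refl) D)
      (≤-trans (≤-reflexive (*-zeroʳ (8 * A * C))) z≤n) ≤-refl
      (≤-trans (≤-reflexive (trans (cong (8 * 1 * A *_) (*-zeroʳ C)) (*-zeroʳ (8 * 1 * A)))) z≤n)
      (≤-trans (≤-reflexive (regroup A w C L)) sparse)
      where
      regroup : ∀ A w C L → 8 * 1 * A * (w * (C * L)) ≡ 8 * A * C * (L * w)
      regroup = solve-∀
  shrink π πs@(π′ ∷ πs′) G K A C 1≤A 1≤C K⊆G G≤m capped (codeg ∷ codegs) dense sparse =
    cover-weaken ≤-refl (λ I ind → ind , _) (λ _ → id)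
      (cover-bind (cover-weaken ≤-refl (λ _ _ → _) (λ _ → id) scan-all) next)
    where
    ℓ = length πs′
    A′ = nextA (suc ℓ) A
    C′ = nextC T A C
    s₀ = sparseness T ℓ A′ C′
    1≤A′ : 1 ≤ A′
    1≤A′ = *-mono-≤ {1} {8 * suc (suc ℓ)} (s≤s z≤n) 1≤A
    C≤C′ : C ≤ C′
    C≤C′ = begin
      C                   ≡⟨ trans (*-identityʳ (1 * C)) (*-identityˡ C) ⟨
      1 * C * 1           ≤⟨ *-mono-≤ (*-monoˡ-≤ C (*-mono-≤ {1} {16} (s≤s z≤n) 1≤A)) 1≤T ⟩
      16 * A * C * T      ≡⟨ regroup A C T ⟩
      2 * (8 * A * C) * T ∎
      where
      open ≤-Reasoning
      regroup : ∀ A C T → 16 * A * C * T ≡ 2 * (8 * A * C) * T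
      regroup = solve-∀
    part : ∀ {x} → x ≤ A′ * C + C′ + s₀ → x * (L * w) ≤ m
    part x≤ = ≤-trans (*-monoˡ-≤ (L * w) x≤) sparse
    -- Since a later coordinate exists, its capped degrees can be summed; `sparse` turns the error
    -- into a second m.
    bounded : ∀ K′ → Capped L C′ K′ G πs → C′ * ∣ K′ ∣ ≤ 2 * m
    bounded K′ capped′ = begin
      C′ * ∣ K′ ∣                ≤⟨ capped-total {L} {C′} {K′} {G} capped′ (here refl) ⟩
      ∣ G ∣ + w * (C′ * L)       ≡⟨ cong (∣ G ∣ +_) (regroup w C′ L) ⟩
      ∣ G ∣ + C′ * (L * w)       ≤⟨ +-mono-≤ G≤m (part (≤-trans (m≤n+m C′ (A′ * C)) (m≤m+n _ s₀))) ⟩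
      m + m                      ≡⟨ cong (m +_) (+-identityʳ m) ⟨
      2 * m ∎
      where
      open ≤-Reasoning
      regroup : ∀ w C L → w * (C * L) ≡ C * (L * w)
      regroup = solve-∀
    sparse₀ : A′ * (w * (C * L)) ≤ m
    sparse₀ = ≤-trans (≤-reflexive (regroup A′ w C L)) (part (≤-trans (m≤m+n (A′ * C) C′) (m≤m+n _ s₀)))
      where
      regroup : ∀ A w C L → A * (w * (C * L)) ≡ A * C * (L * w)
      regroup = solve-∀
    module D = Dichotomy G K π πs A C 1≤A 1≤C K⊆G capped (λ ρ → All.lookup codeg) dense bounded C≤C′ sparse₀
    open D using (scan-all)
    module S = Scan L m G K π πs C′ (8 * A * C * w) K⊆G (λ ρ → All.lookup codeg) bounded
    z = touchFactor (suc ℓ) A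
    weaken : ∀ {x y} → x ≤ z → m ≤ x * y → m ≤ z * y
    weaken {y = y} x≤z m≤ = ≤-trans m≤ (*-monoˡ-≤ y x≤z)
    next : ∀ S → S.Scanned (λ _ → false) (λ _ → false) (allFin w) S →
           Cover (λ I → (Independent K (π ∷ πs) I × ⊤) × S.Fits I S) Avoids (Touched z G (π ∷ πs))
                 (paths w a ^ length πs′)
    next S@(K′ , D) sc = decide (m ≤? C′ * A′ * ∣ K′ ∣)
      where
      decide : Dec (m ≤ C′ * A′ * ∣ K′ ∣) →
                Cover (λ I → (Independent K (π ∷ πs) I × ⊤) × S.Fits I S) Avoids (Touched z G (π ∷ πs))
                      (paths w a ^ length πs′)
      decide (yes dense′) =
        cover-weaken ≤-refl remaining
          (λ _ → there ∘ Any.map (weaken (m≤n+m _ (8 * A))))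
          (shrink π′ πs′ G K′ A′ C′ 1≤A′ (≤-trans 1≤C C≤C′) (λ e → K⊆G e ∘ S.Scanned.⊆K sc e) G≤m
                  (S.Scanned.capped sc) codegs dense′ (part (m≤n+m s₀ _)))
        where
        -- An edge of `K′` has its current coordinate in `I`, so the one outside `I` comes later.
        remaining : ∀ I → (Independent K (π ∷ πs) I × ⊤) × S.Fits I (K′ , D) → Independent K′ πs I
        remaining I ((ind , _) , (chosen , _)) e e∈E k′ with ind e e∈E (S.Scanned.⊆K sc e k′)
        ... | here πe∉I with () ← trans (sym (chosen e k′)) πe∉I
        ... | there ∉I  = ∉I
      decide (no ¬dense′) =
        cover-weaken (m^n>0 (paths w a) {{>-nonZero (1≤paths w a)}} (length πs′)) (λ _ → id) (λ _ → id)
          (cover-one D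
            (here (weaken (m≤m+n (8 * A) _)
              (D.marked-many {K′} {D} (λ y → S.Scanned.exhausted sc y (∈-allFin y)) (<⇒≤ (≰⇒> ¬dense′)))))
            (λ { I (_ , (_ , avoids)) → avoids }))

  -- Repeated deletion of excluded vertices.

  module Iteration (π : Coord) (πs : List Coord) (G : Sub) (A : ℕ) (1≤A : 1 ≤ A) (G≤m : ∣ G ∣ ≤ m)
                   (codeg : AllPairs (Codegree≤ L G) (π ∷ πs))
                   (sparse : sparseness T (length πs) A 1 * (L * w) ≤ m) where

    ℓ Z : ℕ
    ℓ = length πs
    Z = touchFactor ℓ A

    untouched : VertexSet → Sub
    untouched D e = G e ∧ not (any (λ ρ → D (ρ e)) (π ∷ πs))

    untouched⊆G : ∀ D → untouched D ⊆ G
    untouched⊆G D e = proj₁ ∘ ∧-true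

    _∪_ : VertexSet → VertexSet → VertexSet
    (D ∪ D′) y = D y ∨ D′ y

    Sparse : VertexSet → Set
    Sparse D = A * ∣ untouched D ∣ ≤ m

    removed : ∀ D D′ {ρ} → ρ ∈ π ∷ πs →
              ∣ untouched (D ∪ D′) ∣ + ∣ (λ e → untouched D e ∧ D′ (ρ e)) ∣ ≤ ∣ untouched D ∣
    removed D D′ {ρ} ρ∈ = ≤-trans (≤-reflexive (sym (∑-+ E _ _))) (∑-mono E bound)
      where
      bound : ∀ e → 𝟙 (untouched (D ∪ D′) e) + 𝟙 (untouched D e ∧ D′ (ρ e)) ≤ 𝟙 (untouched D e)
      bound e with D′ (ρ e) in eq
      ... | true rewrite any-true (λ ρ → (D ∪ D′) (ρ e)) (π ∷ πs) ρ∈ (true-∨ʳ {D (ρ e)} eq) =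
        exclusive (G e) (untouched D e)
        where
        exclusive : ∀ g u → 𝟙 (g ∧ false) + 𝟙 (u ∧ true) ≤ 𝟙 u
        exclusive true  true  = ≤-refl
        exclusive true  false = ≤-refl
        exclusive false true  = ≤-refl
        exclusive false false = ≤-refl
      ... | false = begin
        𝟙 (untouched (D ∪ D′) e) + 𝟙 (untouched D e ∧ false) ≡⟨ cong (𝟙 (untouched (D ∪ D′) e) +_) (none (untouched D e)) ⟩
        𝟙 (untouched (D ∪ D′) e) + 0                         ≡⟨ +-identityʳ _ ⟩
        𝟙 (untouched (D ∪ D′) e)                             ≤⟨ 𝟙-mono smaller ⟩
        𝟙 (untouched D e) ∎
        where
        open ≤-Reasoning
        none : ∀ u → 𝟙 (u ∧ false) ≡ 0
        none true  = refl
        none false = refl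
        smaller : untouched (D ∪ D′) e ≡ true → untouched D e ≡ true
        smaller h with g , n ← ∧-true {G e} h =
          true-∧ g (not-mono (any-mono {p = λ ρ → D (ρ e)} {λ ρ → (D ∪ D′) (ρ e)} (π ∷ πs)
                                       (λ ρ _ → true-∨ˡ)) n)

    -- Deleting edges cannot raise codegrees, so every round starts with the same `L`.
    restrict-codegree : ∀ D → AllPairs (Codegree≤ L (untouched D)) (π ∷ πs)
    restrict-codegree D = AllPairs.map
      (λ c≤ y u → ≤-trans (∣∣-mono (λ e h → let t , p = ∧-true h in true-∧ (untouched⊆G D e t) p)) (c≤ y u)) codeg

    -- A round removes at least `m / Z` untouched edges and so pays for one unit of `fuel`. Starting
    -- with `Z` units is enough because `∣ G ∣ ≤ m`.
    iterate : ∀ fuel D → Z * ∣ untouched D ∣ ≤ fuel * m →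
              Cover (λ I → Independent G (π ∷ πs) I × Avoids I D) Avoids Sparse ((paths w a ^ ℓ) ^ fuel)
    iterate fuel D Z≤ = decide fuel Z≤ (A * ∣ untouched D ∣ ≤? m)
      where
      decide : ∀ fuel → Z * ∣ untouched D ∣ ≤ fuel * m → Dec (A * ∣ untouched D ∣ ≤ m) →
                Cover (λ I → Independent G (π ∷ πs) I × Avoids I D) Avoids Sparse ((paths w a ^ ℓ) ^ fuel)
      decide fuel Z≤ (yes A≤) = cover-weaken (m^n>0 _ {{m^n≢0 (paths w a) ℓ {{>-nonZero (1≤paths w a)}}}} fuel)
                       (λ _ → id) (λ _ → id) (cover-one D A≤ (λ _ → proj₂))
      -- Without fuel `Z * ∣ untouched D ∣` is 0, and `A ≤ Z`, so the stopping test must have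
      -- succeeded.
      decide zero Z≤ (no A≰) = contradiction empty A≰
        where
        8A≤Z : ∀ ℓ → 8 * A ≤ touchFactor ℓ A
        8A≤Z zero    = ≤-refl
        8A≤Z (suc ℓ) = m≤m+n _ _
        empty : A * ∣ untouched D ∣ ≤ m
        empty = ≤-trans (*-monoˡ-≤ _ (≤-trans (m≤n*m A 8) (8A≤Z ℓ))) (≤-trans Z≤ z≤n)
      decide (suc fuel) Z≤ (no A≰) =
        cover-bind (cover-weaken ≤-refl (λ { I (ind , _) e e∈E t → ind e e∈E (untouched⊆G D e t) }) (λ _ → id)
                     -- A round starts afresh with `K = G′` and cap ratio 1, where the cap is
                     -- trivial.
                     (shrink π πs G′ G′ A 1 1≤A ≤-refl (λ _ → id)
                       (≤-trans (∣∣-mono (untouched⊆G D)) G≤m) capped (restrict-codegree D)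
                       (≤-trans (<⇒≤ (≰⇒> A≰)) (≤-reflexive (cong (_* ∣ G′ ∣) (sym (*-identityˡ A)))))
                       sparse))
          (λ D′ touched → cover-weaken ≤-refl (λ { I ((ind , av) , av′) → ind , avoid-∪ I D′ av av′ }) (λ _ → id)
                            (iterate fuel (D ∪ D′) (progress D′ touched)))
        where
        G′ = untouched D
        capped : Capped L 1 G′ G′ (π ∷ πs)
        capped ρ _ u = ≤-trans (≤-reflexive (*-identityˡ _)) (m≤m+n _ _)
        avoid-∪ : ∀ I D′ → Avoids I D → Avoids I D′ → Avoids I (D ∪ D′)
        avoid-∪ I D′ av av′ y h with ∨-true h
        ... | inj₁ d = av y d
        ... | inj₂ d = av′ y d
        progress : ∀ D′ → Touched Z G′ (π ∷ πs) D′ → Z * ∣ untouched (D ∪ D′) ∣ ≤ fuel * m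
        progress D′ touched with ρ , ρ∈ , m≤ ← find touched =
          +-cancelʳ-≤ m (Z * ∣ untouched (D ∪ D′) ∣) (fuel * m) (begin
            Z * ∣ untouched (D ∪ D′) ∣ + m                                        ≤⟨ +-monoʳ-≤ _ m≤ ⟩
            Z * ∣ untouched (D ∪ D′) ∣ + Z * ∣ (λ e → G′ e ∧ D′ (ρ e)) ∣          ≡⟨ *-distribˡ-+ Z ∣ untouched (D ∪ D′) ∣ _ ⟨
            Z * (∣ untouched (D ∪ D′) ∣ + ∣ (λ e → G′ e ∧ D′ (ρ e)) ∣)            ≤⟨ *-monoʳ-≤ Z (removed D D′ ρ∈) ⟩
            Z * ∣ G′ ∣                                                            ≤⟨ Z≤ ⟩
            m + fuel * m                                                          ≡⟨ +-comm m _ ⟩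
            fuel * m + m ∎)
          where open ≤-Reasoning

    containers : Cover (Independent G (π ∷ πs)) Avoids Sparse ((paths w a ^ ℓ) ^ Z)
    containers = cover-weaken ≤-refl (λ _ ind → ind , (λ _ ())) (λ _ → id)
      (iterate Z (λ _ → false) (*-monoʳ-≤ Z (≤-trans (∣∣-mono (untouched⊆G (λ _ → false))) G≤m)))

-- The number of outcomes

-- `paths d a` is the sum of the binomial coefficients C(d,i) over i ≤ a. Weighting the i-th term by
-- the (a - i)-th power of X, which is at least 1, bounds the sum by X^a (1 + 1/X)^d.
paths-bound : ∀ X → 1 ≤ X → ∀ d a → paths d a * X ^ d ≤ X ^ a * suc X ^ d
paths-bound X 1≤X zero a = *-monoˡ-≤ 1 (m^n>0 X {{>-nonZero 1≤X}} a)
paths-bound X 1≤X (suc d) zero = *-monoʳ-≤ 1 (^-monoˡ-≤ (suc d) (n≤1+n X))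
paths-bound X 1≤X (suc d) (suc a) = begin
  (paths d a + paths d (suc a)) * (X * X ^ d)
    ≡⟨ expand (paths d a) (paths d (suc a)) X (X ^ d) ⟩
  X * (paths d a * X ^ d) + X * (paths d (suc a) * X ^ d)
    ≤⟨ +-mono-≤ (*-monoʳ-≤ X (paths-bound X 1≤X d a)) (*-monoʳ-≤ X (paths-bound X 1≤X d (suc a))) ⟩
  X * (X ^ a * suc X ^ d) + X * (X * X ^ a * suc X ^ d)
    ≡⟨ collect X (X ^ a) (suc X ^ d) ⟩
  X * X ^ a * (suc X * suc X ^ d) ∎
  where
  open ≤-Reasoning
  expand : ∀ p q X Y → (p + q) * (X * Y) ≡ X * (p * Y) + X * (q * Y)
  expand = solve-∀
  collect : ∀ X Y S → X * (Y * S) + X * (X * Y * S) ≡ X * Y * (suc X * S)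
  collect = solve-∀

-- Bernoulli's inequality (1 − 1/(X+1))^j ≥ 1 − j/(X+1), with r = X + 1 − j.
bernoulli : ∀ X j r → j + r ≡ suc X → suc X ^ j * r ≤ X ^ j * suc X
bernoulli X zero    r refl = ≤-refl
bernoulli X (suc j) r eq   = begin
  suc X * suc X ^ j * r       ≡⟨ left X (suc X ^ j) r ⟩
  suc X ^ j * (X * r + r)     ≤⟨ *-monoʳ-≤ (suc X ^ j) (+-monoʳ-≤ (X * r) r≤X) ⟩
  suc X ^ j * (X * r + X)     ≡⟨ middle X (suc X ^ j) r ⟩
  X * (suc X ^ j * suc r)     ≤⟨ *-monoʳ-≤ X (bernoulli X j (suc r) (trans (+-suc j r) eq)) ⟩
  X * (X ^ j * suc X)         ≡⟨ *-assoc X (X ^ j) (suc X) ⟨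
  X * X ^ j * suc X ∎
  where
  open ≤-Reasoning
  r≤X : r ≤ X
  r≤X = ≤-trans (m≤n+m r j) (≤-reflexive (suc-injective eq))
  left : ∀ X S r → suc X * S * r ≡ S * (X * r + r)
  left = solve-∀
  middle : ∀ X S r → S * (X * r + X) ≡ X * (S * suc r)
  middle = solve-∀

-- With X = 2Y and j = Y, Bernoulli's inequality bounds (1 - 1/(2Y+1))^Y below by (Y+1)/(2Y+1),
-- hence by 1/2.
ratio^Y≤2 : ∀ Y → suc (2 * Y) ^ Y ≤ 2 * (2 * Y) ^ Y
ratio^Y≤2 Y = *-cancelʳ-≤ _ _ (suc Y) (begin
  suc (2 * Y) ^ Y * suc Y        ≤⟨ bernoulli (2 * Y) Y (suc Y) (halves Y) ⟩
  (2 * Y) ^ Y * suc (2 * Y)      ≤⟨ *-monoʳ-≤ ((2 * Y) ^ Y) (n≤1+n _) ⟩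
  (2 * Y) ^ Y * suc (suc (2 * Y)) ≡⟨ double ((2 * Y) ^ Y) Y ⟩
  2 * (2 * Y) ^ Y * suc Y ∎)
  where
  open ≤-Reasoning
  halves : ∀ Y → Y + suc Y ≡ suc (2 * Y)
  halves = solve-∀
  double : ∀ P Y → P * suc (suc (2 * Y)) ≡ 2 * P * suc Y
  double = solve-∀

n≤2^n : ∀ n → n ≤ 2 ^ n
n≤2^n zero    = z≤n
n≤2^n (suc n) = begin
  1 + n            ≤⟨ +-mono-≤ (m^n>0 2 n) (n≤2^n n) ⟩
  2 ^ n + 2 ^ n    ≡⟨ cong (2 ^ n +_) (+-identityʳ (2 ^ n)) ⟨
  2 ^ suc n ∎
  where open ≤-Reasoning

^-cancelˡ-≤ : ∀ n .{{_ : NonZero n}} {x y} → x ^ n ≤ y ^ n → x ≤ y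
^-cancelˡ-≤ n {x} {y} h = ≮⇒≥ λ y<x → ≤⇒≯ h (^-monoˡ-< n y<x)

^-distribʳ-* : ∀ x y n → (x * y) ^ n ≡ x ^ n * y ^ n
^-distribʳ-* x y zero    = refl
^-distribʳ-* x y (suc n) = trans (cong (x * y *_) (^-distribʳ-* x y n)) (interchange x y (x ^ n) (y ^ n))
  where
  interchange : ∀ a b c d → a * b * (c * d) ≡ a * c * (b * d)
  interchange = solve-∀

^-swap : ∀ x m n → (x ^ m) ^ n ≡ (x ^ n) ^ m
^-swap x m n = trans (^-*-assoc x m n) (trans (cong (x ^_) (*-comm m n)) (sym (^-*-assoc x n m)))

-- The Y-th power of `paths-bound` at X = 2Y: then (1 + 1/X)^(wY) is at most 2^w, and X is bounded
-- crudely by 2^X. Powers are compared so that no roots occur.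
paths^Y : ∀ Y → 1 ≤ Y → ∀ w a → paths w a ^ Y ≤ 2 ^ (2 * Y * a * Y + w)
paths^Y Y 1≤Y w a = *-cancelʳ-≤ _ _ ((X ^ w) ^ Y) {{m^n≢0 (X ^ w) Y {{m^n≢0 X w {{X≢0}}}}}} (begin
  paths w a ^ Y * (X ^ w) ^ Y               ≡⟨ ^-distribʳ-* (paths w a) (X ^ w) Y ⟨
  (paths w a * X ^ w) ^ Y                   ≤⟨ ^-monoˡ-≤ Y (paths-bound X 1≤X w a) ⟩
  (X ^ a * suc X ^ w) ^ Y                   ≡⟨ ^-distribʳ-* (X ^ a) (suc X ^ w) Y ⟩
  (X ^ a) ^ Y * (suc X ^ w) ^ Y             ≤⟨ *-monoˡ-≤ _ (^-monoˡ-≤ Y (^-monoˡ-≤ a (n≤2^n X))) ⟩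
  ((2 ^ X) ^ a) ^ Y * (suc X ^ w) ^ Y       ≡⟨ cong₂ _*_ (trans (cong (_^ Y) (^-*-assoc 2 X a)) (^-*-assoc 2 (X * a) Y))
                                                        (^-swap (suc X) w Y) ⟩
  2 ^ (X * a * Y) * (suc X ^ Y) ^ w         ≤⟨ *-monoʳ-≤ (2 ^ (X * a * Y)) (^-monoˡ-≤ w (ratio^Y≤2 Y)) ⟩
  2 ^ (X * a * Y) * (2 * X ^ Y) ^ w         ≡⟨ cong (2 ^ (X * a * Y) *_) (trans (^-distribʳ-* 2 (X ^ Y) w)
                                                                       (cong (2 ^ w *_) (^-swap X Y w))) ⟩
  2 ^ (X * a * Y) * (2 ^ w * (X ^ w) ^ Y)   ≡⟨ *-assoc (2 ^ (X * a * Y)) (2 ^ w) _ ⟨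
  2 ^ (X * a * Y) * 2 ^ w * (X ^ w) ^ Y     ≡⟨ cong (_* (X ^ w) ^ Y) (^-distribˡ-+-* 2 (X * a * Y) w) ⟨
  2 ^ (X * a * Y + w) * (X ^ w) ^ Y ∎)
  where
  open ≤-Reasoning
  X = 2 * Y
  1≤X : 1 ≤ X
  1≤X = *-mono-≤ {1} {2} (s≤s z≤n) 1≤Y
  X≢0 : NonZero X
  X≢0 = >-nonZero 1≤X

-- A Y-th root in `paths^Y` would leave the exponent R(2Ya + vk/Y). The last two hypotheses make
-- each summand at most v/2.
paths^R : ∀ R k v a Y → 1 ≤ Y → 2 * R * k ≤ Y → 2 * R * (2 * Y) * a ≤ v → paths (v * k) a ^ R ≤ 2 ^ v
paths^R R k v a Y 1≤Y k≤ a≤ = ^-cancelˡ-≤ Y {{>-nonZero 1≤Y}} (begin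
  (paths (v * k) a ^ R) ^ Y              ≡⟨ ^-swap (paths (v * k) a) R Y ⟩
  (paths (v * k) a ^ Y) ^ R              ≤⟨ ^-monoˡ-≤ R (paths^Y Y 1≤Y (v * k) a) ⟩
  (2 ^ (2 * Y * a * Y + v * k)) ^ R      ≡⟨ ^-*-assoc 2 (2 * Y * a * Y + v * k) R ⟩
  2 ^ ((2 * Y * a * Y + v * k) * R)      ≤⟨ ^-monoʳ-≤ 2 exponent ⟩
  2 ^ (v * Y)                            ≡⟨ ^-*-assoc 2 v Y ⟨
  (2 ^ v) ^ Y ∎)
  where
  open ≤-Reasoning
  exponent : (2 * Y * a * Y + v * k) * R ≤ v * Y
  exponent = *-cancelˡ-≤ 2 (begin
    2 * ((2 * Y * a * Y + v * k) * R)        ≡⟨ expand Y a v k R ⟩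
    2 * R * (2 * Y) * a * Y + v * (2 * R * k) ≤⟨ +-mono-≤ (*-monoˡ-≤ Y a≤) (*-monoʳ-≤ v k≤) ⟩
    v * Y + v * Y                             ≡⟨ cong (v * Y +_) (+-identityʳ (v * Y)) ⟨
    2 * (v * Y) ∎)
    where
    expand : ∀ Y a v k R → 2 * ((2 * Y * a * Y + v * k) * R) ≡ 2 * R * (2 * Y) * a * Y + v * (2 * R * k)
    expand = solve-∀

-- Embeddings through pairs of large codegree

unique-⊆⇒length≤ : ∀ {A : Set} {xs : List A} → Unique xs → ∀ ys → (∀ {x} → x ∈ xs → x ∈ ys) → length xs ≤ length ys
unique-⊆⇒length≤ []            ys xs⊆ys = z≤n
unique-⊆⇒length≤ {xs = x ∷ xs} (x∉ ∷ uniq) ys xs⊆ys with as , bs , refl ← ∈-∃++ (xs⊆ys (here refl)) = begin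
  suc (length xs)             ≤⟨ s≤s (unique-⊆⇒length≤ uniq (as ++ bs) rest) ⟩
  suc (length (as ++ bs))     ≡⟨ cong suc (length-++ as) ⟩
  suc (length as + length bs) ≡⟨ +-suc (length as) (length bs) ⟨
  length as + suc (length bs) ≡⟨ length-++ as ⟨
  length (as ++ x ∷ bs) ∎
  where
  open ≤-Reasoning
  rest : ∀ {y} → y ∈ xs → y ∈ as ++ bs
  rest y∈xs with ∈-++⁻ as (xs⊆ys (there y∈xs))
  ... | inj₁ y∈as         = ∈-++⁺ˡ y∈as
  ... | inj₂ (here refl)  = contradiction refl (All.lookup x∉ y∈xs)
  ... | inj₂ (there y∈bs) = ∈-++⁺ʳ as y∈bs

vectorsOver : ∀ {A : Set} → List A → ∀ n → List (Vec A n)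
vectorsOver xs zero    = [] ∷ []
vectorsOver xs (suc n) = cartesianProductWith _∷_ xs (vectorsOver xs n)

length-cartesianProductWith : ∀ {A B C : Set} (f : A → B → C) xs ys →
                              length (cartesianProductWith f xs ys) ≡ length xs * length ys
length-cartesianProductWith f []       ys = refl
length-cartesianProductWith f (x ∷ xs) ys =
  trans (length-++ (map (f x) ys)) (cong₂ _+_ (length-map (f x) ys) (length-cartesianProductWith f xs ys))

length-vectorsOver : ∀ {A : Set} (xs : List A) n → length (vectorsOver xs n) ≡ length xs ^ n
length-vectorsOver xs zero    = refl
length-vectorsOver xs (suc n) =
  trans (length-cartesianProductWith _∷_ xs _) (cong (length xs *_) (length-vectorsOver xs n))

∈-vectorsOver : ∀ {A : Set} (xs : List A) {n} (ψ : Vec A n) → (∀ i → lookup ψ i ∈ xs) → ψ ∈ vectorsOver xs n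
∈-vectorsOver xs []      ψ⊆ = here refl
∈-vectorsOver xs (y ∷ ψ) ψ⊆ =
  ∈-cartesianProductWith⁺ _∷_ (ψ⊆ zero) (∈-vectorsOver xs ψ (ψ⊆ ∘ suc))

module _ {s v : ℕ} where

  open VecDec {A = Fin v} Finₚ._≟_ using (_∈?_)

  Contained? : (φ ψ : Emb s v) → Dec (∀ i → lookup ψ i VecMem.∈ φ)
  Contained? φ ψ = Finₚ.all? (λ i → lookup ψ i ∈? φ)

  common : (φ ψ : Emb s v) → List (Fin v)
  common φ ψ = filter (λ y → (y ∈? φ) ×-dec (y ∈? ψ)) (allFin v)

  common-unique : ∀ φ ψ → Unique (common φ ψ)
  common-unique φ ψ = Uniqueₚ.filter⁺ (λ y → (y ∈? φ) ×-dec (y ∈? ψ)) (Uniqueₚ.allFin⁺ v)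

  2≤overlap : ∀ (φ ψ : Emb s v) {i j} → Injective _≡_ _≡_ (lookup φ) → i ≢ j →
              lookup ψ i ≡ lookup φ i → lookup ψ j ≡ lookup φ j → 1 < imgOverlap φ ψ
  2≤overlap φ ψ {i} {j} inj i≢j ψi ψj =
    unique-⊆⇒length≤ {xs = lookup φ i ∷ lookup φ j ∷ []} (((i≢j ∘ inj) ∷ []) ∷ [] ∷ []) (common φ ψ)
      λ { (here refl) → shared i ψi ; (there (here refl)) → shared j ψj }
    where
    shared : ∀ l → lookup ψ l ≡ lookup φ l → lookup φ l ∈ common φ ψ
    shared l ψl = ∈-filter⁺ (λ y → (y ∈? φ) ×-dec (y ∈? ψ)) (∈-allFin (lookup φ l))
      (∈-lookup l φ , subst (VecMem._∈ ψ) ψl (∈-lookup l ψ))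

  -- If `lookup ψ i` were missing from `φ`, it and the common values would be more than `s` distinct
  -- entries of `ψ`.
  overlap≥s⇒contained : ∀ (φ ψ : Emb s v) → s ≤ imgOverlap φ ψ → ∀ i → lookup ψ i VecMem.∈ φ
  overlap≥s⇒contained φ ψ s≤ i with lookup ψ i ∈? φ
  ... | yes ψi∈φ = ψi∈φ
  ... | no  ψi∉φ = contradiction s≤ (<⇒≱ (begin-strict
    length (common φ ψ)
      <⟨ unique-⊆⇒length≤ {xs = lookup ψ i ∷ common φ ψ} (new ∷ common-unique φ ψ) (toList ψ) inψ ⟩
    length (toList ψ)
      ≡⟨ Vecₚ.length-toList ψ ⟩
    s ∎))
    where
    open ≤-Reasoning
    split : ∀ {y} → y ∈ common φ ψ → y VecMem.∈ φ × y VecMem.∈ ψ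
    split = proj₂ ∘ ∈-filter⁻ (λ y → (y ∈? φ) ×-dec (y ∈? ψ)) {xs = allFin v}
    new : All (lookup ψ i ≢_) (common φ ψ)
    new = All.tabulate λ { y∈ refl → ψi∉φ (proj₁ (split y∈)) }
    inψ : ∀ {y} → y ∈ lookup ψ i ∷ common φ ψ → y ∈ toList ψ
    inψ (here refl) = ∈-toList⁺ (∈-lookup i ψ)
    inψ (there y∈)  = ∈-toList⁺ (proj₂ (split y∈))

  count-contained : ∀ (φ : Emb s v) {E : List (Emb s v)} → Unique E → count (does ∘ Contained? φ) E ≤ s ^ s
  count-contained φ {E} uniq = begin
    count (does ∘ Contained? φ) E
      ≡⟨ length-filter-count (Contained? φ) E ⟨
    length (filter (Contained? φ) E)
      ≤⟨ unique-⊆⇒length≤ (Uniqueₚ.filter⁺ (Contained? φ) uniq) (vectorsOver (toList φ) s) over-φ ⟩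
    length (vectorsOver (toList φ) s)
      ≡⟨ length-vectorsOver (toList φ) s ⟩
    length (toList φ) ^ s
      ≡⟨ cong (_^ s) (Vecₚ.length-toList φ) ⟩
    s ^ s ∎
    where
    open ≤-Reasoning
    over-φ : ∀ {ψ} → ψ ∈ filter (Contained? φ) E → ψ ∈ vectorsOver (toList φ) s
    over-φ {ψ} ψ∈ = ∈-vectorsOver (toList φ) ψ
      (λ i → ∈-toList⁺ (proj₂ (∈-filter⁻ (Contained? φ) {xs = E} ψ∈) i))

-- `Icount` for a bare list of embeddings; on `emb V N n` it unfolds to the same number.
icount : ∀ {s v} → List (Emb s v) → ℕ
icount {s} E = length (filter (λ p → (1 <? imgOverlap (proj₁ p) (proj₂ p))
                                ×-dec (imgOverlap (proj₁ p) (proj₂ p) <? s))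
                              (cartesianProduct E E))

module Heavy {s v : ℕ} (E : List (Emb s v)) (uniq : Unique E)
             (inj : ∀ φ → φ ∈ E → Injective _≡_ _≡_ (lookup φ)) (κ : ℕ) where

  I e : ℕ
  I = icount E
  e = length E

  through : (i j : Fin s) (x y : Fin v) → Emb s v → Bool
  through i j x y ψ = (lookup ψ i ≡ᵇ x) ∧ (lookup ψ j ≡ᵇ y)

  codegree : (i j : Fin s) (x y : Fin v) → ℕ
  codegree i j x y = count (through i j x y) E

  heavyPair : (i j : Fin s) (x y : Fin v) → Bool
  heavyPair i j x y = not (does (codegree i j x y * κ ≤? e))

  heavyAt : (i j : Fin s) → Emb s v → Bool
  heavyAt i j φ = not (i ≡ᵇ j) ∧ heavyPair i j (lookup φ i) (lookup φ j)

  heavy : Emb s v → Bool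
  heavy φ = any (λ i → any (λ j → heavyAt i j φ) (allFin s)) (allFin s)

  inner : Emb s v → Emb s v → Bool
  inner φ ψ = does ((1 <? imgOverlap φ ψ) ×-dec (imgOverlap φ ψ <? s))

  I≡ : I ≡ ∑ E (λ φ → ∑ E (λ ψ → 𝟙 (inner φ ψ)))
  I≡ = trans (length-filter-count
               (λ p → (1 <? imgOverlap (proj₁ p) (proj₂ p)) ×-dec (imgOverlap (proj₁ p) (proj₂ p) <? s))
               (cartesianProduct E E))
             (∑-cartesianProduct E E _)

  -- Agreement at two coordinates forces an overlap of at least 2. If the overlap is below `s` the
  -- pair is `inner`; otherwise `ψ` has all its values in `φ`.
  classify : ∀ {i j} → i ≢ j → ∀ φ → φ ∈ E → ∀ ψ →
             𝟙 (through i j (lookup φ i) (lookup φ j) ψ) ≤ 𝟙 (inner φ ψ) + 𝟙 (does (Contained? φ ψ))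
  classify {i} {j} i≢j φ φ∈E ψ with through i j (lookup φ i) (lookup φ j) ψ in eq
  ... | false = z≤n
  ... | true with a , b ← ∧-true eq = split (imgOverlap φ ψ <? s)
    where
    1<ov : 1 < imgOverlap φ ψ
    1<ov = 2≤overlap φ ψ (inj φ φ∈E) i≢j (≡ᵇ-sound _ _ a) (≡ᵇ-sound _ _ b)
    split : Dec (imgOverlap φ ψ < s) → 1 ≤ 𝟙 (inner φ ψ) + 𝟙 (does (Contained? φ ψ))
    split (yes ov<s) = ≤-trans
      (≤-reflexive (cong 𝟙 (sym (dec-true ((1 <? imgOverlap φ ψ) ×-dec (imgOverlap φ ψ <? s)) (1<ov , ov<s)))))
      (m≤m+n _ _)
    split (no ov≮s)  = ≤-trans
      (≤-reflexive (cong 𝟙 (sym (dec-true (Contained? φ ψ) (overlap≥s⇒contained φ ψ (≮⇒≥ ov≮s))))))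
      (m≤n+m _ (𝟙 (inner φ ψ)))

  ∑-codegree : ∀ {i j} → i ≢ j → ∑ E (λ φ → codegree i j (lookup φ i) (lookup φ j)) ≤ I + e * s ^ s
  ∑-codegree {i} {j} i≢j = begin
    ∑ E (λ φ → codegree i j (lookup φ i) (lookup φ j))
      ≤⟨ ∑-mono-∈ E (λ φ φ∈ → ≤-trans (∑-mono E (classify i≢j φ φ∈)) (≤-reflexive (∑-+ E _ _))) ⟩
    ∑ E (λ φ → ∑ E (λ ψ → 𝟙 (inner φ ψ)) + count (does ∘ Contained? φ) E)
      ≡⟨ ∑-+ E _ _ ⟩
    ∑ E (λ φ → ∑ E (λ ψ → 𝟙 (inner φ ψ))) + ∑ E (λ φ → count (does ∘ Contained? φ) E)
      ≤⟨ +-mono-≤ (≤-reflexive (sym I≡)) (∑-mono E (λ φ → count-contained φ uniq)) ⟩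
    I + ∑ E (λ _ → s ^ s)
      ≡⟨ cong (I +_) (∑-const E (s ^ s)) ⟩
    I + e * s ^ s ∎
    where open ≤-Reasoning

  -- Markov's inequality: a heavy `φ` has codegree above `e / κ` at its own pair, and these
  -- codegrees add up to at most `I + e * s ^ s`.
  count-heavyAt : ∀ i j → e * count (heavyAt i j) E ≤ κ * (I + e * s ^ s)
  count-heavyAt i j = begin
    e * count (heavyAt i j) E                     ≡⟨ ∑-* e E _ ⟩
    ∑ E (λ φ → e * 𝟙 (heavyAt i j φ))             ≤⟨ by-cases (i Finₚ.≟ j) ⟩
    κ * (I + e * s ^ s) ∎
    where
    open ≤-Reasoning
    by-cases : Dec (i ≡ j) → ∑ E (λ φ → e * 𝟙 (heavyAt i j φ)) ≤ κ * (I + e * s ^ s)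
    by-cases (yes refl) = begin
      ∑ E (λ φ → e * 𝟙 (heavyAt i i φ))  ≤⟨ ∑-mono E diagonal ⟩
      ∑ E (λ _ → 0)                      ≡⟨ ∑-zero E ⟩
      0                                  ≤⟨ z≤n ⟩
      κ * (I + e * s ^ s) ∎
      where
      diagonal : ∀ φ → e * 𝟙 (heavyAt i i φ) ≤ 0
      diagonal φ = ≤-reflexive (trans
        (cong (λ b → e * 𝟙 (not b ∧ heavyPair i i (lookup φ i) (lookup φ i))) (≡ᵇ-refl i)) (*-zeroʳ e))
    by-cases (no i≢j) = begin
      ∑ E (λ φ → e * 𝟙 (heavyAt i j φ))                             ≤⟨ ∑-mono E bound ⟩
      ∑ E (λ φ → κ * codegree i j (lookup φ i) (lookup φ j))        ≡⟨ ∑-* κ E _ ⟨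
      κ * ∑ E (λ φ → codegree i j (lookup φ i) (lookup φ j))        ≤⟨ *-monoʳ-≤ κ (∑-codegree i≢j) ⟩
      κ * (I + e * s ^ s) ∎
      where
      bound : ∀ φ → e * 𝟙 (heavyAt i j φ) ≤ κ * codegree i j (lookup φ i) (lookup φ j)
      bound φ = ≤-trans (≤-reflexive (*-comm e _)) (𝟙-* (heavyAt i j φ) (λ h →
        ≤-trans (<⇒≤ (false-≤? {codegree i j (lookup φ i) (lookup φ j) * κ} (not-true (proj₂ (∧-true {not (i ≡ᵇ j)} h)))))
                (≤-reflexive (*-comm _ κ))))

  count-heavy : e * count heavy E ≤ s * (s * (κ * (I + e * s ^ s)))
  count-heavy = begin
    e * count heavy E
      ≤⟨ *-monoʳ-≤ e (∑-mono E spread) ⟩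
    e * ∑ E (λ φ → ∑ Ss (λ i → ∑ Ss (λ j → 𝟙 (heavyAt i j φ))))
      ≡⟨ cong (e *_) (trans (∑-swap E Ss _) (∑-cong Ss (λ i → ∑-swap E Ss _))) ⟩
    e * ∑ Ss (λ i → ∑ Ss (λ j → count (heavyAt i j) E))
      ≡⟨ trans (∑-* e Ss _) (∑-cong Ss (λ i → ∑-* e Ss _)) ⟩
    ∑ Ss (λ i → ∑ Ss (λ j → e * count (heavyAt i j) E))
      ≤⟨ ∑-mono Ss (λ i → ≤-trans (∑-mono Ss (λ j → count-heavyAt i j)) (≤-reflexive (∑-allFin-const s _))) ⟩
    ∑ Ss (λ _ → s * (κ * (I + e * s ^ s)))
      ≡⟨ ∑-allFin-const s _ ⟩
    s * (s * (κ * (I + e * s ^ s))) ∎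
    where
    open ≤-Reasoning
    Ss = allFin s
    spread : ∀ φ → 𝟙 (heavy φ) ≤ ∑ Ss (λ i → ∑ Ss (λ j → 𝟙 (heavyAt i j φ)))
    spread φ = ≤-trans (𝟙-any (λ i → any (λ j → heavyAt i j φ) Ss) Ss) (∑-mono Ss (λ i → 𝟙-any (λ j → heavyAt i j φ) Ss))

  -- If the pair is not heavy, its full codegree is already at most `L`. If it is heavy, so are all
  -- embeddings through it, and none is counted.
  light-codegree : ∀ {i j} → i ≢ j → ∀ L → e < suc L * κ → ∀ x y →
                   count (λ φ → not (heavy φ) ∧ through i j x y φ) E ≤ L
  light-codegree {i} {j} i≢j L e<κ x y = split (codegree i j x y * κ ≤? e)
    where
    split : Dec (codegree i j x y * κ ≤ e) → count (λ φ → not (heavy φ) ∧ through i j x y φ) E ≤ L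
    split (yes few) = ≤-trans (count-mono E (λ φ → proj₂ ∘ ∧-true {not (heavy φ)}))
      (≤-pred (*-cancelʳ-< κ (codegree i j x y) (suc L) (≤-<-trans few e<κ)))
    split (no many) = ≤-trans (≤-reflexive (count-false E none)) z≤n
      where
      none : ∀ φ → not (heavy φ) ∧ through i j x y φ ≡ true → false ≡ true
      none φ h with l , t ← ∧-true h with p , q ← ∧-true t
        with refl ← ≡ᵇ-sound (lookup φ i) x p with refl ← ≡ᵇ-sound (lookup φ j) y q =
        clash (any-true (λ i → any (λ j → heavyAt i j φ) (allFin s)) (allFin s) (∈-allFin i)
                 (any-true (λ j → heavyAt i j φ) (allFin s) (∈-allFin j)
                   (true-∧ (cong not (dec-false (i Finₚ.≟ j) i≢j))
                           (cong not (dec-false (codegree i j (lookup φ i) (lookup φ j) * κ ≤? e) many))))) l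

-- Templates from sets of excluded vertices

lookup-ext : ∀ {A : Set} {n} {xs ys : Vec A n} → (∀ i → lookup xs i ≡ lookup ys i) → xs ≡ ys
lookup-ext {xs = xs} {ys} eq =
  trans (sym (Vecₚ.tabulate∘lookup xs)) (trans (Vecₚ.tabulate-cong eq) (Vecₚ.tabulate∘lookup ys))

restrict-≡ : ∀ {k s v} (c : Colouring k v) (φ : Emb s v) {f} →
             (∀ x → lookup c (lookup φ x) ≡ lookup f x) → restrict c φ ≡ f
restrict-≡ c φ h = lookup-ext λ x → trans (Vecₚ.lookup-map x (lookup c) φ) (h x)

Avoiding : ∀ {k s v} → List (Emb s v) → List (Colouring k s) → Colouring k v → Set
Avoiding E 𝓕 c = ∀ φ → φ ∈ E → ¬ (restrict c φ ∈ 𝓕)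

badCount : ∀ {k s v} → List (Emb s v) → List (Colouring k s) → Template k v → ℕ
badCount E 𝓕 t = length (filter (λ p → proj₂ p ∈⟨ restrict (tmpl t) (proj₁ p) ⟩?) (cartesianProduct E 𝓕))

module _ {v k : ℕ} where

  subsets : (Fin (v * k) → Bool) → Vec (Subset k) v
  subsets D = Vec.tabulate (λ x → Vec.tabulate (λ i → not (D (combine x i))))

  lookup-subsets : ∀ D x i → lookup (lookup (subsets D) x) i ≡ not (D (combine x i))
  lookup-subsets D x i =
    trans (cong (λ p → lookup p i) (Vecₚ.lookup∘tabulate (λ x → Vec.tabulate (λ i → not (D (combine x i)))) x))
          (Vecₚ.lookup∘tabulate (λ i → not (D (combine x i))) i)

  ∈-subsets⁺ : ∀ D x i → D (combine x i) ≡ false → i Subset.∈ lookup (subsets D) x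
  ∈-subsets⁺ D x i h = Vecₚ.lookup⇒[]= i _ (trans (lookup-subsets D x i) (cong not h))

  ∈-subsets⁻ : ∀ D x i → i Subset.∈ lookup (subsets D) x → D (combine x i) ≡ false
  ∈-subsets⁻ D x i h = not-true (trans (sym (lookup-subsets D x i)) (Vecₚ.[]=⇒lookup h))

  -- A set that leaves some vertex without a colour is dropped, since a `Template` must be nonempty
  -- everywhere; no colouring is lost by this.
  templates : List (Fin (v * k) → Bool) → List (Template k v)
  templates []       = []
  templates (D ∷ Ds) with Finₚ.all? (λ x → Subsetₚ.nonempty? (lookup (subsets D) x))
  ... | yes ne = template (subsets D) ne ∷ templates Ds
  ... | no  _  = templates Ds

  length-templates : ∀ Ds → length (templates Ds) ≤ length Ds
  length-templates []       = z≤n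
  length-templates (D ∷ Ds) with Finₚ.all? (λ x → Subsetₚ.nonempty? (lookup (subsets D) x))
  ... | yes _ = s≤s (length-templates Ds)
  ... | no  _ = m≤n⇒m≤1+n (length-templates Ds)

  ∈-templates⁻ : ∀ Ds {t} → t ∈ templates Ds → ∃ λ D → D ∈ Ds × tmpl t ≡ subsets D
  ∈-templates⁻ (D ∷ Ds) t∈ with Finₚ.all? (λ x → Subsetₚ.nonempty? (lookup (subsets D) x))
  ∈-templates⁻ (D ∷ Ds) (here refl) | yes _ = D , here refl , refl
  ∈-templates⁻ (D ∷ Ds) (there t∈)  | yes _ with D′ , D′∈ , eq ← ∈-templates⁻ Ds t∈ = D′ , there D′∈ , eq
  ∈-templates⁻ (D ∷ Ds) t∈          | no  _ with D′ , D′∈ , eq ← ∈-templates⁻ Ds t∈ = D′ , there D′∈ , eq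

  ∈-templates⁺ : ∀ Ds {D} {c : Colouring k v} → D ∈ Ds → c ∈⟨ subsets D ⟩ → ∃ λ t → t ∈ templates Ds × c ∈⟨ tmpl t ⟩
  ∈-templates⁺ (D ∷ Ds) {c = c} D∈ c∈ with Finₚ.all? (λ x → Subsetₚ.nonempty? (lookup (subsets D) x))
  ∈-templates⁺ (D ∷ Ds) (here refl) c∈ | yes ne = template (subsets D) ne , here refl , c∈
  ∈-templates⁺ (D ∷ Ds) {c = c} (here refl) c∈ | no ¬ne = contradiction (λ x → lookup c x , c∈ x) ¬ne
  ∈-templates⁺ (D ∷ Ds) {c = c} (there D∈) c∈ | yes _ with t , t∈ , f ← ∈-templates⁺ Ds {c = c} D∈ c∈ = t , there t∈ , f
  ∈-templates⁺ (D ∷ Ds) {c = c} (there D∈) c∈ | no  _ = ∈-templates⁺ Ds {c = c} D∈ c∈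

  graph : Colouring k v → Fin (v * k) → Bool
  graph c u = lookup c (proj₁ (remQuot {v} k u)) ≡ᵇ proj₂ (remQuot {v} k u)

  graph-combine : ∀ c x i → graph c (combine x i) ≡ (lookup c x ≡ᵇ i)
  graph-combine c x i = cong (λ r → lookup c (proj₁ r) ≡ᵇ proj₂ r) (Finₚ.remQuot-combine x i)

  avoids⇒∈subsets : ∀ c D → (∀ u → D u ≡ true → graph c u ≡ false) → c ∈⟨ subsets D ⟩
  avoids⇒∈subsets c D avoids x = ∈-subsets⁺ D x (lookup c x) clear
    where
    clear : D (combine x (lookup c x)) ≡ false
    clear with D (combine x (lookup c x)) in eq
    ... | false = refl
    ... | true with () ← trans (sym (trans (graph-combine c x (lookup c x)) (≡ᵇ-refl (lookup c x)))) (avoids _ eq)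

-- The hypergraph of forbidden tuples.

module Templates {s v k : ℕ} (E : List (Emb (suc s) v)) (𝓕 : List (Colouring k (suc s)))
                 (light : Emb (suc s) v → Bool) (L T a A : ℕ) where

  X : Set
  X = Emb (suc s) v × Colouring k (suc s)

  pairs : List X
  pairs = cartesianProduct E 𝓕

  e F m : ℕ
  e = length E
  F = length 𝓕
  m = e * F

  open Hypergraph pairs (v * k)

  coord : Fin (suc s) → Coord
  coord x (φ , f) = combine (lookup φ x) (lookup f x)

  π : Coord
  π = coord zero

  πs : List Coord
  πs = map coord (tabulate suc)

  ℓ≡s : length πs ≡ s
  ℓ≡s = trans (length-map coord (tabulate suc)) (length-tabulate suc)

  G : Sub
  G (φ , _) = light φ

  length-pairs : ∀ (p : X → Bool) → count p pairs ≤ m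
  length-pairs p = ≤-trans (count≤length p pairs) (≤-reflexive (length-cartesianProductWith _,_ E 𝓕))

  ∑-first : ∀ (p : Emb (suc s) v → Bool) → count (p ∘ proj₁) pairs ≡ F * count p E
  ∑-first p = begin
    count (p ∘ proj₁) pairs               ≡⟨ ∑-cartesianProduct E 𝓕 _ ⟩
    ∑ E (λ φ → ∑ 𝓕 (λ _ → 𝟙 (p φ)))       ≡⟨ ∑-cong E (λ φ → ∑-const 𝓕 _) ⟩
    ∑ E (λ φ → F * 𝟙 (p φ))               ≡⟨ ∑-* F E _ ⟨
    F * count p E ∎
    where open ≡-Reasoning

  module _ (1≤w : 1 ≤ v * k) (1≤m : 1 ≤ m) (1≤T : 1 ≤ T) (w<aT : v * k < a * T) (1≤A : 1 ≤ A)
           (codeg : ∀ {i j} → i ≢ j → ∀ x y →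
                    F * count (λ φ → light φ ∧ ((lookup φ i ≡ᵇ x) ∧ (lookup φ j ≡ᵇ y))) E ≤ L)
           (sparse : sparseness T s A 1 * (L * (v * k)) ≤ m) where

    -- All pairs `(φ , f)` through two given vertices have `φ` through the two underlying points,
    -- and each `φ` occurs with at most `F` colourings.
    codegrees : AllPairs (Codegree≤ L G) (π ∷ πs)
    codegrees = AllPairsₚ.map⁺ (AllPairs.map bound (Uniqueₚ.allFin⁺ (suc s)))
      where
      bound : ∀ {i j} → i ≢ j → Codegree≤ L G (coord i) (coord j)
      bound {i} {j} i≢j y u = ≤-trans (∣∣-mono project) (≤-trans (≤-reflexive (∑-first p)) (codeg i≢j y₁ u₁))
        where
        y₁ = proj₁ (remQuot {v} k y)
        u₁ = proj₁ (remQuot {v} k u)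
        p : Emb (suc s) v → Bool
        p φ = light φ ∧ ((lookup φ i ≡ᵇ y₁) ∧ (lookup φ j ≡ᵇ u₁))
        first : ∀ l (e : X) z → (coord l e ≡ᵇ z) ≡ true → (lookup (proj₁ e) l ≡ᵇ proj₁ (remQuot {v} k z)) ≡ true
        first l (φ , f) z h with refl ← ≡ᵇ-sound (coord l (φ , f)) z h =
          trans (cong (λ q → lookup φ l ≡ᵇ proj₁ q) (Finₚ.remQuot-combine (lookup φ l) (lookup f l))) (≡ᵇ-refl (lookup φ l))
        project : (λ e → G e ∧ ((coord i e ≡ᵇ y) ∧ (coord j e ≡ᵇ u))) ⊆ (p ∘ proj₁)
        project e h with g , t ← ∧-true {G e} h with c , d ← ∧-true {coord i e ≡ᵇ y} t =
          true-∧ g (true-∧ (first i e y c) (first j e u d))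

    module C = Containers pairs (v * k) m L T a 1≤w 1≤m 1≤T w<aT
    module It = C.Iteration π πs G A 1≤A (length-pairs G) codegrees
                  (subst (λ ℓ → sparseness T ℓ A 1 * (L * (v * k)) ≤ m) (sym ℓ≡s) sparse)
    -- As `restrict c φ` differs from the forbidden `f`, they disagree at some `x`, and
    -- `coord x (φ , f)` lies off the graph of `c`.
    independent : ∀ c → Avoiding E 𝓕 c → C.Independent G (π ∷ πs) (graph c)
    independent c c∈ (φ , f) p∈ _ with φ∈ , f∈ ← ∈-cartesianProduct⁻ E 𝓕 p∈
      with x , cφx≢fx ← Finₚ.¬∀⟶∃¬ (suc s) (λ x → lookup c (lookup φ x) ≡ lookup f x)
                          (λ x → lookup c (lookup φ x) Finₚ.≟ lookup f x)
                          (λ h → c∈ φ φ∈ (subst (_∈ 𝓕) (sym (restrict-≡ c φ h)) f∈)) =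
      lose {xs = π ∷ πs} (∈-map⁺ coord (∈-allFin x))
        (trans (graph-combine c (lookup φ x) (lookup f x)) (dec-false (lookup c (lookup φ x) Finₚ.≟ lookup f x) cφx≢fx))

    module FromCover {n} (cov : Cover (C.Independent G (π ∷ πs)) C.Avoids It.Sparse n) where

      module Cov = Cover cov

      𝓣 : List (Template k v)
      𝓣 = templates {v} Cov.outcomes

      𝓣-covers : ∀ c → Avoiding E 𝓕 c → ∃ λ t → t ∈ 𝓣 × c ∈⟨ tmpl t ⟩
      𝓣-covers c c∈ with D , D∈ , avoids ← Cov.covers (graph c) (independent c c∈) =
        ∈-templates⁺ Cov.outcomes {c = c} D∈ (avoids⇒∈subsets c D avoids)

      -- A pair that fits the template has no coordinate in `D`. So it is an untouched edge of `G`,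
      -- or its embedding was discarded as not light.
      𝓣-bad : ∀ t → t ∈ 𝓣 → A * badCount E 𝓕 t ≤ m + A * (F * count (not ∘ light) E)
      𝓣-bad t t∈ with D , D∈ , eq ← ∈-templates⁻ Cov.outcomes t∈ = begin
        A * badCount E 𝓕 t
          ≡⟨ cong (A *_) (length-filter-count (λ p → proj₂ p ∈⟨ restrict (tmpl t) (proj₁ p) ⟩?) pairs) ⟩
        A * count inside pairs
          ≤⟨ *-monoʳ-≤ A (∑-mono pairs (classify D eq)) ⟩
        A * ∑ pairs (λ p → 𝟙 (It.untouched D p) + 𝟙 (not (light (proj₁ p))))
          ≡⟨ cong (A *_) (trans (∑-+ pairs _ _) (cong (∣ It.untouched D ∣ +_) (∑-first (not ∘ light)))) ⟩
        A * (∣ It.untouched D ∣ + F * count (not ∘ light) E)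
          ≡⟨ *-distribˡ-+ A ∣ It.untouched D ∣ _ ⟩
        A * ∣ It.untouched D ∣ + A * (F * count (not ∘ light) E)
          ≤⟨ +-monoˡ-≤ _ (Cov.good D D∈) ⟩
        m + A * (F * count (not ∘ light) E) ∎
        where
        open ≤-Reasoning
        inside : X → Bool
        inside p = does (proj₂ p ∈⟨ restrict (tmpl t) (proj₁ p) ⟩?)
        classify : ∀ D → tmpl t ≡ subsets D → ∀ p → 𝟙 (inside p) ≤ 𝟙 (It.untouched D p) + 𝟙 (not (light (proj₁ p)))
        classify D eq (φ , f) = by-cases (f ∈⟨ restrict (tmpl t) φ ⟩?)
          where
          rhs : ℕ
          rhs = 𝟙 (It.untouched D (φ , f)) + 𝟙 (not (light φ))
          clear : f ∈⟨ restrict (tmpl t) φ ⟩ → any (λ ρ → D (ρ (φ , f))) (π ∷ πs) ≡ false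
          clear f∈ = any-false (λ ρ → D (ρ (φ , f))) (π ∷ πs) λ ρ ρ∈ → at ρ (∈-map⁻ coord {xs = allFin (suc s)} ρ∈)
            where
            at : ∀ ρ → (∃ λ x → x ∈ allFin (suc s) × ρ ≡ coord x) → D (ρ (φ , f)) ≡ false
            at _ (x , _ , refl) = ∈-subsets⁻ D (lookup φ x) (lookup f x)
              (subst (λ t → lookup f x Subset.∈ lookup t (lookup φ x)) eq
                (subst (lookup f x Subset.∈_) (Vecₚ.lookup-map x (lookup (tmpl t)) φ) (f∈ x)))
          total : ∀ b c → c ≡ false → 1 ≤ 𝟙 (b ∧ not c) + 𝟙 (not b)
          total true  c refl = s≤s z≤n
          total false c refl = s≤s z≤n
          by-cases : (d : Dec (f ∈⟨ restrict (tmpl t) φ ⟩)) → 𝟙 (does d) ≤ rhs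
          by-cases (yes f∈) = total (light φ) _ (clear f∈)
          by-cases (no _)   = z≤n

    templates-exist : Σ (List (Template k v)) λ 𝓣 →
        (∀ c → Avoiding E 𝓕 c → ∃ λ t → t ∈ 𝓣 × c ∈⟨ tmpl t ⟩)
      × (∀ t → t ∈ 𝓣 → A * badCount E 𝓕 t ≤ m + A * (F * count (not ∘ light) E))
      × length 𝓣 ≤ (paths (v * k) a ^ s) ^ touchFactor s A
    templates-exist = build containers
      where
      containers : Cover (C.Independent G (π ∷ πs)) C.Avoids It.Sparse ((paths (v * k) a ^ s) ^ touchFactor s A)
      containers = cover-weaken
        (≤-reflexive (cong (λ ℓ → (paths (v * k) a ^ ℓ) ^ touchFactor ℓ A) ℓ≡s)) (λ _ → id) (λ _ → id) It.containers
      build : ∀ {n} → Cover (C.Independent G (π ∷ πs)) C.Avoids It.Sparse n → Σ (List (Template k v)) λ 𝓣 →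
          (∀ c → Avoiding E 𝓕 c → ∃ λ t → t ∈ 𝓣 × c ∈⟨ tmpl t ⟩)
        × (∀ t → t ∈ 𝓣 → A * badCount E 𝓕 t ≤ m + A * (F * count (not ∘ light) E))
        × length 𝓣 ≤ n
      build cov = 𝓣 , 𝓣-covers , 𝓣-bad , ≤-trans (length-templates {v} {k} Cov.outcomes) Cov.size≤
        where open FromCover cov

-- Choice of constants and the argument for one n.

m<[1+m/n]*n : ∀ m n .{{_ : NonZero n}} → m < suc (m / n) * n
m<[1+m/n]*n m n = begin-strict
  m                        ≡⟨ m≡m%n+[m/n]*n m n ⟩
  m % n + m / n * n <⟨ +-monoˡ-< (m / n * n) (m%n<n m n) ⟩
  suc (m / n) * n ∎
  where open ≤-Reasoning

-- Here `p / q` stands for ε. Denominators are cleared, and the bound on the number of templates is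
-- raised to the power `q`.
TemplateFamily : ∀ {s v k} (E : List (Emb s v)) (𝓕 : List (Colouring k s)) (p q : ℕ) → Set
TemplateFamily {s} {v} {k} E 𝓕 p q =
  Σ (List (Template k v)) λ 𝓣 →
      (∀ c → Avoiding E 𝓕 c → ∃ λ t → t ∈ 𝓣 × c ∈⟨ tmpl t ⟩)
    × (∀ t → t ∈ 𝓣 → q * badCount E 𝓕 t ≤ p * length E)
    × (length 𝓣 ^ q ≤ k ^ (p * v))

-- The budget is `suc d`: the hypothesis on `v` covers the extra unit, and `T`, exceeding
-- `2 * c * k`, keeps `2 * c * d` at most `v`.
few-paths : ∀ R k v → 1 ≤ k → let Y = suc (2 * R * k) ; c = 2 * R * (2 * Y) ; T = suc (2 * c * k) in
            2 * c ≤ v → paths (v * k) (suc (v * k / T)) ^ R ≤ 2 ^ v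
few-paths R k v 1≤k c≤v = paths^R R k v (suc d) Y (s≤s z≤n) (n≤1+n _) (*-cancelˡ-≤ 2 (begin
  2 * (c * suc d)       ≡⟨ expand c d ⟩
  2 * c + 2 * c * d     ≤⟨ +-mono-≤ c≤v cd≤v ⟩
  v + v                 ≡⟨ cong (v +_) (+-identityʳ v) ⟨
  2 * v ∎))
  where
  open ≤-Reasoning
  Y = suc (2 * R * k)
  c = 2 * R * (2 * Y)
  T = suc (2 * c * k)
  d = v * k / T
  expand : ∀ c d → 2 * (c * suc d) ≡ 2 * c + 2 * c * d
  expand = solve-∀
  swap : ∀ c k d → 2 * c * d * k ≡ d * (2 * c * k)
  swap = solve-∀
  cd≤v : 2 * c * d ≤ v
  cd≤v = *-cancelʳ-≤ _ _ k {{>-nonZero 1≤k}} (begin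
    2 * c * d * k     ≡⟨ swap c k d ⟩
    d * (2 * c * k)   ≤⟨ *-monoʳ-≤ d (n≤1+n _) ⟩
    d * T             ≤⟨ m/n*n≤m (v * k) T ⟩
    v * k ∎)

-- The order of choice matters: the number Z of rounds does not depend on T, so T can be taken large
-- enough that the outcomes of all Z rounds number at most 2^(v/q); Η then bounds the codegrees.
module Constants (s k q F : ℕ) where

  A Z R Y c T Η : ℕ
  A = 2 * q * F
  Z = touchFactor s A
  R = s * Z * q
  Y = suc (2 * R * k)
  c = 2 * R * (2 * Y)
  T = suc (2 * c * k)
  Η = sparseness T s A 1

module _ {s v k : ℕ} (E : List (Emb (suc s) v)) (𝓕 : List (Colouring k (suc s)))
         (p q : ℕ) (1≤p : 1 ≤ p) (1≤q : 1 ≤ q) (2≤k : 2 ≤ k) (1≤v : 1 ≤ v)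
         (1≤e : 1 ≤ length E) (1≤F : 1 ≤ length 𝓕) where

  open Constants s k q (length 𝓕)

  -- Untouched pairs account for at most e/(2q) of `b`, and the pairs at the `h` discarded
  -- embeddings for another e/(2q).
  few-bad : ∀ {e F b h} → 1 ≤ F → 2 * q * F * b ≤ e * F + 2 * q * F * (F * h) → 2 * q * F * h ≤ e → q * b ≤ p * e
  few-bad {e} {F} {b} {h} 1≤F bad≤ h≤ = ≤-trans (*-cancelˡ-≤ 2 (*-cancelˡ-≤ F {{>-nonZero 1≤F}} (begin
    F * (2 * (q * b))                      ≡⟨ left F q b ⟩
    2 * q * F * b                          ≤⟨ bad≤ ⟩
    e * F + 2 * q * F * (F * h)            ≡⟨ right e F (2 * q * F) h ⟩
    F * (e + 2 * q * F * h)                ≤⟨ *-monoʳ-≤ F (+-monoʳ-≤ e h≤) ⟩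
    F * (e + e)                            ≡⟨ cong (λ x → F * (e + x)) (+-identityʳ e) ⟨
    F * (2 * e) ∎))) (m≤n*m e p {{>-nonZero 1≤p}})
    where
    open ≤-Reasoning
    left : ∀ F q b → F * (2 * (q * b)) ≡ 2 * q * F * b
    left = solve-∀
    right : ∀ e F A h → e * F + A * (F * h) ≡ F * (e + A * h)
    right = solve-∀

  templates-from-light : (light : Emb (suc s) v → Bool) (L : ℕ) →
             (∀ {i j} → i ≢ j → ∀ x y →
               length 𝓕 * count (λ φ → light φ ∧ ((lookup φ i ≡ᵇ x) ∧ (lookup φ j ≡ᵇ y))) E ≤ L) →
             Η * (L * (v * k)) ≤ length E * length 𝓕 →
             A * count (not ∘ light) E ≤ length E → 2 * c ≤ v → TemplateFamily E 𝓕 p q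
  templates-from-light light L codeg sparse few-heavy c≤v = finish
    (Templates.templates-exist E 𝓕 light L T (suc (v * k / T)) A
      (*-mono-≤ 1≤v (<⇒≤ 2≤k)) (*-mono-≤ 1≤e 1≤F) (s≤s z≤n) (m<[1+m/n]*n (v * k) T)
      (*-mono-≤ {1} {2 * q} (*-mono-≤ {1} {2} (s≤s z≤n) 1≤q) 1≤F) codeg sparse)
    where
    P = paths (v * k) (suc (v * k / T))
    few-templates : ∀ {x} → x ≤ (P ^ s) ^ Z → x ^ q ≤ k ^ (p * v)
    -- The exponent `R = s * Z * q` combines the scans of a round, the rounds, and the power `q`.
    few-templates {x} x≤ = begin
      x ^ q                ≤⟨ ^-monoˡ-≤ q x≤ ⟩
      ((P ^ s) ^ Z) ^ q    ≡⟨ trans (cong (_^ q) (^-*-assoc P s Z)) (^-*-assoc P (s * Z) q) ⟩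
      P ^ R                ≤⟨ few-paths R k v (<⇒≤ 2≤k) c≤v ⟩
      2 ^ v                ≤⟨ ^-monoʳ-≤ 2 (m≤n*m v p {{>-nonZero 1≤p}}) ⟩
      2 ^ (p * v)          ≤⟨ ^-monoˡ-≤ (p * v) 2≤k ⟩
      k ^ (p * v) ∎
      where open ≤-Reasoning
    finish : (Σ (List (Template k v)) λ 𝓣 →
        (∀ c → Avoiding E 𝓕 c → ∃ λ t → t ∈ 𝓣 × c ∈⟨ tmpl t ⟩)
      × (∀ t → t ∈ 𝓣 → A * badCount E 𝓕 t ≤ length E * length 𝓕 + A * (length 𝓕 * count (not ∘ light) E))
      × length 𝓣 ≤ (P ^ s) ^ Z) → TemplateFamily E 𝓕 p q
    finish (𝓣 , covers , bad≤ , size≤) =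
      𝓣 , covers , (λ t t∈ → few-bad 1≤F (bad≤ t t∈) few-heavy) , few-templates size≤

-- After multiplication by 2e, the share of `I` and the share of the contained embeddings each cost
-- at most `e * e`.
heavy-few : ∀ {e I h S N v κ A Η k} → 1 ≤ e → κ ≡ Η * (v * k) → e * h ≤ S * (S * (κ * (I + e * N))) →
            let ρ = A * S * S * Η * k in 2 * ρ * (v * I) ≤ e * e → 2 * ρ * N * v ≤ e → A * h ≤ e
heavy-few {e} {I} {h} {S} {N} {v} {κ} {A} {Η} {k} 1≤e refl h≤ I≤ v≤ =
  *-cancelˡ-≤ e {{>-nonZero 1≤e}} (*-cancelˡ-≤ 2 (begin
    2 * (e * (A * h))                                     ≡⟨ left A e h ⟩
    2 * A * (e * h)                                       ≤⟨ *-monoʳ-≤ (2 * A) h≤ ⟩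
    2 * A * (S * (S * (Η * (v * k) * (I + e * N))))       ≡⟨ right A S Η v k I e N ⟩
    2 * (A * S * S * Η * k) * (v * I) + 2 * (A * S * S * Η * k) * N * v * e
                                                          ≤⟨ +-mono-≤ I≤ (*-monoˡ-≤ e v≤) ⟩
    e * e + e * e                                         ≡⟨ cong (e * e +_) (+-identityʳ (e * e)) ⟨
    2 * (e * e) ∎))
  where
  open ≤-Reasoning
  left : ∀ A e h → 2 * (e * (A * h)) ≡ 2 * A * (e * h)
  left = solve-∀
  right : ∀ A S Η v k I e N → 2 * A * (S * (S * (Η * (v * k) * (I + e * N)))) ≡
          2 * (A * S * S * Η * k) * (v * I) + 2 * (A * S * S * Η * k) * N * v * e
  right = solve-∀

A≤sparseness : ∀ T s A C → A * C ≤ sparseness T s A C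
A≤sparseness T zero    A C = *-monoˡ-≤ C (m≤n*m A 8)
A≤sparseness T (suc s) A C = ≤-trans (*-monoˡ-≤ C (m≤n*m A (8 * suc (suc s)))) (≤-trans (m≤m+n _ _) (m≤m+n _ _))

module _ {s v k : ℕ} (E : List (Emb (suc s) v)) (𝓕 : List (Colouring k (suc s)))
         (p q : ℕ) (1≤p : 1 ≤ p) (1≤q : 1 ≤ q) (2≤k : 2 ≤ k) (1≤v : 1 ≤ v)
         (1≤e : 1 ≤ length E) (1≤F : 1 ≤ length 𝓕) where

  open Constants s k q (length 𝓕)

  -- Embeddings heavy at the threshold `e / κ` are discarded. With `κ = Η * (v * k)` the codegree
  -- bound `F * L₀` is small enough for `sparse`, while `κ` is only linear in `v`, so the two bounds
  -- on `length E` keep the heavy embeddings few.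
  many-embeddings : Unique E → (∀ φ → φ ∈ E → Injective _≡_ _≡_ (lookup φ)) →
    let ρ = A * suc s * suc s * Η * k in
    2 * ρ * (v * icount E) ≤ length E * length E → 2 * ρ * suc s ^ suc s * v ≤ length E →
    2 * c ≤ v → TemplateFamily E 𝓕 p q
  many-embeddings uniq inj I≤ e≥ c≤v =
    templates-from-light E 𝓕 p q 1≤p 1≤q 2≤k 1≤v 1≤e 1≤F (not ∘ H.heavy) (F * L₀)
      (λ i≢j x y → *-monoʳ-≤ F (H.light-codegree i≢j L₀ (m<[1+m/n]*n e κ) x y))
      sparse
      (≤-trans (*-monoʳ-≤ A (count-mono E (λ φ → not-not)))
        (heavy-few {e} {icount E} {count H.heavy E} {suc s} {suc s ^ suc s} {v} {κ} {A} {Η} {k}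
          1≤e refl H.count-heavy I≤ e≥))
      c≤v
    where
    e = length E
    F = length 𝓕
    κ = Η * (v * k)
    1≤Η : 1 ≤ Η
    1≤Η = ≤-trans (*-mono-≤ {1} {A} {1} {1} (*-mono-≤ {1} {2 * q} (*-mono-≤ {1} {2} (s≤s z≤n) 1≤q) 1≤F) ≤-refl)
                  (A≤sparseness T s A 1)
    instance
      κ≢0 : NonZero κ
      κ≢0 = >-nonZero (*-mono-≤ 1≤Η (*-mono-≤ 1≤v (<⇒≤ 2≤k)))
    L₀ = e / κ
    module H = Heavy E uniq inj κ
    not-not : ∀ {b} → not (not b) ≡ true → b ≡ true
    not-not {true} _ = refl
    sparse : Η * (F * L₀ * (v * k)) ≤ e * F
    sparse = begin
      Η * (F * L₀ * (v * k))   ≡⟨ regroup Η F L₀ (v * k) ⟩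
      L₀ * (Η * (v * k)) * F   ≤⟨ *-monoˡ-≤ F (m/n*n≤m e κ) ⟩
      e * F ∎
      where
      open ≤-Reasoning
      regroup : ∀ Η F L w → Η * (F * L * w) ≡ L * (Η * w) * F
      regroup = solve-∀

-- Degenerate cases and the conclusion for all large n.

module _ {k : ℕ} where

  full : ∀ v → Template (suc k) v
  full v = template (Vec.replicate v Subset.⊤) λ x → zero , mem x zero
    where
    mem : ∀ x i → i Subset.∈ lookup (Vec.replicate v Subset.⊤) x
    mem x i = subst (i Subset.∈_) (sym (Vecₚ.lookup-replicate x Subset.⊤)) Subsetₚ.∈⊤

  ∈-full : ∀ v (c : Colouring (suc k) v) → c ∈⟨ tmpl (full v) ⟩
  ∈-full v c x = subst (lookup c x Subset.∈_) (sym (Vecₚ.lookup-replicate x Subset.⊤)) Subsetₚ.∈⊤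

no-embeddings : ∀ {k s v} (𝓕 : List (Colouring (suc k) s)) p q → TemplateFamily {s} {v} [] 𝓕 p q
no-embeddings {k} {s} {v} 𝓕 p q =
  full v ∷ [] , (λ c _ → full v , here refl , ∈-full v c) ,
  (λ _ _ → ≤-trans (≤-reflexive (*-zeroʳ q)) z≤n) ,
  ≤-trans (≤-reflexive (^-zeroˡ q)) (m^n>0 (suc k) (p * v))

-- The empty family works, as `0 ^ q` is 0 for positive `q`.
no-colourings : ∀ {k s v} (E : List (Emb s v)) (𝓕 : List (Colouring k s)) p q → 1 ≤ q →
                (∀ c → ¬ Avoiding E 𝓕 c) → TemplateFamily E 𝓕 p q
no-colourings E 𝓕 p (suc q) _ none = [] , (λ c c∈ → contradiction c∈ (none c)) , (λ _ ()) , z≤n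

-- The only colouring of V_N is the forbidden one, so a single embedding rules out every colouring.
one-pattern : ∀ {k s v} (E : List (Emb s v)) (𝓕 : List (Colouring k s)) p q → 1 ≤ q → 1 ≤ length E → 1 ≤ length 𝓕 →
              (∀ (f g : Colouring k s) → f ≡ g) → TemplateFamily E 𝓕 p q
one-pattern E@(φ ∷ _) 𝓕@(f ∷ _) p q 1≤q _ _ same =
  no-colourings E 𝓕 p q 1≤q λ c c∈ → c∈ φ (here refl) (here (same (restrict c φ) f))

-- The cases in order: no colours, empty V_N, one colour, one point in V_N, and the general case
-- with at least two colours and two points. Wherever an index n has no embeddings, one full
-- template suffices.
templates-eventually : ∀ k s (v : ℕ → ℕ) (E : ∀ n → List (Emb s (v n))) →
  (∀ n φ → φ ∈ E n → Injective _≡_ _≡_ (lookup φ)) → (∀ n → Unique (E n)) →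
  (∀ M → ∃ λ n₁ → ∀ n → n₁ ≤ n → M ≤ v n) →
  (1 < s → ∀ M → ∃ λ n₁ → ∀ n → n₁ ≤ n → M * v n ≤ length (E n)) →
  (1 < s → ∀ m → ∃ λ n₁ → ∀ n → n₁ ≤ n → suc m * (v n * icount (E n)) ≤ length (E n) ^ 2) →
  (𝓕 : List (Colouring k s)) → 1 ≤ length 𝓕 → (p q : ℕ) → 1 ≤ p → 1 ≤ q →
  ∃ λ n₀ → 0 < n₀ × (∀ n → n₀ ≤ n → TemplateFamily (E n) 𝓕 p q)
templates-eventually zero s v E inj uniq grow _ _ 𝓕 1≤F p q 1≤p 1≤q with n₁ , v≥1 ← grow 1 =
  suc n₁ , s≤s z≤n , λ n n≥ → no-colourings (E n) 𝓕 p q 1≤q λ c _ → empty c (v≥1 n (<⇒≤ n≥))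
  where
  empty : ∀ {v} → Colouring 0 v → 1 ≤ v → ⊥
  empty (() ∷ _) _
templates-eventually (suc k) zero v E inj uniq grow _ _ 𝓕 1≤F p q 1≤p 1≤q =
  1 , s≤s z≤n , λ n _ → by-cases (E n)
  where
  by-cases : ∀ {v} (E : List (Emb 0 v)) → TemplateFamily E 𝓕 p q
  by-cases []        = no-embeddings 𝓕 p q
  by-cases E@(_ ∷ _) = one-pattern E 𝓕 p q 1≤q (s≤s z≤n) 1≤F λ { [] [] → refl }
templates-eventually (suc zero) (suc s) v E inj uniq grow _ _ 𝓕 1≤F p q 1≤p 1≤q =
  1 , s≤s z≤n , λ n _ → by-cases (E n)
  where
  by-cases : ∀ {v} (E : List (Emb (suc s) v)) → TemplateFamily E 𝓕 p q
  by-cases []        = no-embeddings 𝓕 p q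
  by-cases E@(_ ∷ _) = one-pattern E 𝓕 p q 1≤q (s≤s z≤n) 1≤F λ f g → lookup-ext λ x → only (lookup f x) (lookup g x)
    where
    only : ∀ (x y : Fin 1) → x ≡ y
    only zero zero = refl
templates-eventually k@(suc (suc _)) (suc zero) v E inj uniq grow _ _ 𝓕 1≤F p q 1≤p 1≤q
  with n₁ , v≥ ← grow (1 + 2 * Constants.c 0 k q (length 𝓕)) =
  suc n₁ , s≤s z≤n , λ n n≥ → by-cases (E n) (v≥ n (<⇒≤ n≥))
  where
  open Constants 0 k q (length 𝓕)
  by-cases : ∀ {v} (E : List (Emb 1 v)) → 1 + 2 * c ≤ v → TemplateFamily E 𝓕 p q
  by-cases []            _  = no-embeddings 𝓕 p q
  by-cases {v} E@(_ ∷ _) v≥ =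
    -- A single coordinate forms no pairs, so `L = 0` is a codegree bound and every embedding counts
    -- as light.
    templates-from-light E 𝓕 p q 1≤p 1≤q (s≤s (s≤s z≤n)) (≤-trans (s≤s z≤n) v≥) (s≤s z≤n) 1≤F (λ _ → true) 0
      (λ { {zero} {zero} i≢i → contradiction refl i≢i })
      (≤-trans (≤-reflexive (*-zeroʳ Η)) z≤n)
      (≤-trans (≤-reflexive (trans (cong (A *_) (∑-zero E)) (*-zeroʳ A))) z≤n)
      (≤-trans (n≤1+n _) v≥)
templates-eventually k@(suc (suc _)) (suc s@(suc _)) v E inj uniq grow dense spread 𝓕 1≤F p q 1≤p 1≤q
  with n₁ , v≥ ← grow (1 + 2 * Constants.c s k q (length 𝓕))
  with n₂ , e≥ ← dense (s≤s (s≤s z≤n))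
         (2 * (Constants.A s k q (length 𝓕) * suc s * suc s * Constants.Η s k q (length 𝓕) * k) * suc s ^ suc s)
  with n₃ , I≤ ← spread (s≤s (s≤s z≤n))
         (2 * (Constants.A s k q (length 𝓕) * suc s * suc s * Constants.Η s k q (length 𝓕) * k)) =
  suc (n₁ + n₂ + n₃) , s≤s z≤n , λ n n≥ → by-cases (E n) (uniq n) (inj n)
    (v≥ n (≤-trans (≤-trans (m≤m+n n₁ n₂) (m≤m+n _ n₃)) (<⇒≤ n≥)))
    (e≥ n (≤-trans (≤-trans (m≤n+m n₂ n₁) (m≤m+n _ n₃)) (<⇒≤ n≥)))
    (I≤ n (≤-trans (m≤n+m n₃ _) (<⇒≤ n≥)))
  where
  open Constants s k q (length 𝓕)
  ρ = A * suc s * suc s * Η * k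
  by-cases : ∀ {v} (E : List (Emb (suc s) v)) → Unique E → (∀ φ → φ ∈ E → Injective _≡_ _≡_ (lookup φ)) →
             1 + 2 * c ≤ v → 2 * ρ * suc s ^ suc s * v ≤ length E →
             suc (2 * ρ) * (v * icount E) ≤ length E ^ 2 → TemplateFamily E 𝓕 p q
  by-cases []            _    _   _  _  _  = no-embeddings 𝓕 p q
  by-cases {v} E@(_ ∷ _) uniq inj v≥ e≥ I≤ =
    many-embeddings E 𝓕 p q 1≤p 1≤q (s≤s (s≤s z≤n)) (≤-trans (s≤s z≤n) v≥) (s≤s z≤n) 1≤F uniq inj
      -- `spread` at `2 * ρ` supplies the factor `suc (2 * ρ)`, one more than is used.
      (≤-trans (*-monoˡ-≤ (v * icount E) (n≤1+n (2 * ρ)))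
        (≤-trans I≤ (≤-reflexive (cong (length E *_) (*-identityʳ (length E))))))
      e≥ (≤-trans (n≤1+n _) v≥)

theorem3p18 : (V : SSEE) → Good V → (k N : ℕ) →
    (𝓕 : List (Colouring k (size V N))) → Unique 𝓕 → 𝓕 ≢ [] →
    (p q : ℕ) → 0 < p → 0 < q →
    ∃ λ n₀ → 0 < n₀ × (∀ n → n₀ ≤ n →
    Σ (List (Template k (size V n))) λ 𝓣 →
    (∀ c → InForb V k N 𝓕 n c → ∃ λ t → t ∈ 𝓣 × c ∈⟨ tmpl t ⟩)
    × (∀ t → t ∈ 𝓣 → q * badPairs V k N 𝓕 n t ≤ p * length (emb V N n))
    × (length 𝓣 ^ q ≤ k ^ (p * size V n)))
theorem3p18 V (grow , dense , spread) k N 𝓕 _ 𝓕≢[] p q =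
  templates-eventually k (size V N) (size V) (emb V N) (emb-inj V N) (emb-uniq V N) grow (dense N) (spread N) 𝓕
    (≢[]⇒1≤length 𝓕 𝓕≢[]) p q
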